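{- Let $r\ge 2$ and $m = 2$. Let $a_{ij}\in\mathbb{C}$ ($1\le i\le 2$, $1\le j\le r$) and $f_i=\sum_{j=1}^r a_{ij}z_j$. Let $S_1$ be the family $(z_1^2,\dots,z_r^2,f_1^2,f_2^2)$ in $\mathbb{C}[z_1,\dots,z_r]$ and $S_2$ the family of all products of two distinct members of $S_1$. Then $S_2$ is linearly independent if and only if $S_1$ is linearly independent.
   Context: For a finite family $S_1=(p_1,\dots,p_l)$ of polynomials and $1\le k\le l$, $S_k$ denotes the family $(p_{i_1}p_{i_2}\cdots p_{i_k})_{1\le i_1<\dots<i_k\le l}$ of the $\binom{l}{k}$ products of $k$ members of $S_1$ with distinct indices. A family is linearly independent (over $\mathbb{C}$) if no nontrivial $\mathbb{C}$-linear combination of its members (counted with their indices, so repeated members make the family dependent) vanishes. -}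

module Defs where

open import Algebra.Bundles using (CommutativeRing)
open import Data.Bool.Base using (if_then_else_)
open import Data.Fin.Base using (Fin)
open import Data.List.Base as List using (List; []; _∷_; _++_; length; lookup)
open import Data.Nat.Base as ℕ using (ℕ; zero; suc)
import Data.Nat.Properties as ℕ
open import Data.Product.Base using (_×_; _,_; proj₁; proj₂; ∃; map₁)
open import Data.Rational.Base as ℚ using (ℚ; 0ℚ; 1ℚ; ½; ∣_∣; _<_; _≤_; 1/_)
import Data.Rational.Properties as ℚ
open import Data.Rational.Solver using (module +-*-Solver)
open import Data.Vec.Base as Vec using (Vec; _[_]≔_)
import Data.Vec.Functional as Vector
open import Data.Vec.Properties using (≡-dec)
open import Level using (0ℓ; _⊔_)
open import Relation.Binary.PropositionalEquality as ≡ using (_≡_)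
open import Relation.Binary.Structures using (IsEquivalence)
open import Relation.Nullary.Decidable using (does)

-- u m n tends to 0 as m and n tend to infinity independently.
record Null (u : ℕ → ℕ → ℚ) : Set where
  constructor mkNull
  field
    tail : ∀ ε → 0ℚ < ε → ∃ λ N → ∀ m n → N ℕ.≤ m → N ℕ.≤ n → ∣ u m n ∣ < ε

-- The bound is only required from some index on.
record Bounded (u : ℕ → ℕ → ℚ) : Set where
  constructor mkBounded
  field
    B     : ℚ
    0<B   : 0ℚ < B
    N     : ℕ
    bound : ∀ m n → N ℕ.≤ m → N ℕ.≤ n → ∣ u m n ∣ < B

private
  *-pos : ∀ {p q} → 0ℚ < p → 0ℚ < q → 0ℚ < p ℚ.* q
  *-pos {p} {q} 0<p 0<q =
    ℚ.positive⁻¹ _ {{ℚ.pos*pos⇒pos p {{ℚ.positive 0<p}} q {{ℚ.positive 0<q}}}}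

  halves : ∀ p → ½ ℚ.* p ℚ.+ ½ ℚ.* p ≡ p
  halves p = ≡.trans (≡.sym (ℚ.*-distribʳ-+ p ½ ½)) (ℚ.*-identityˡ p)

  module Identities where
    open +-*-Solver using (solve; _:+_; _:*_; _:-_; :-_; _:=_)

    sub-add : ∀ a b → a ≡ a ℚ.- b ℚ.+ b
    sub-add = solve 2 (λ a b → a := a :- b :+ b) ≡.refl

    neg-sub : ∀ a b → ℚ.- (a ℚ.- b) ≡ b ℚ.- a
    neg-sub = solve 2 (λ a b → :- (a :- b) := b :- a) ≡.refl

    neg-sub-neg : ∀ a b → ℚ.- (a ℚ.- b) ≡ ℚ.- a ℚ.- (ℚ.- b)
    neg-sub-neg = solve 2 (λ a b → :- (a :- b) := :- a :- (:- b)) ≡.refl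

    sub-sub : ∀ a b c → (a ℚ.- b) ℚ.+ (b ℚ.- c) ≡ a ℚ.- c
    sub-sub = solve 3 (λ a b c → (a :- b) :+ (b :- c) := a :- c) ≡.refl

    +-sub : ∀ a b c d → (a ℚ.- b) ℚ.+ (c ℚ.- d) ≡ (a ℚ.+ c) ℚ.- (b ℚ.+ d)
    +-sub = solve 4 (λ a b c d → (a :- b) :+ (c :- d) := (a :+ c) :- (b :+ d)) ≡.refl

    *-sub : ∀ a b c d → a ℚ.* (c ℚ.- d) ℚ.+ d ℚ.* (a ℚ.- b) ≡ a ℚ.* c ℚ.- b ℚ.* d
    *-sub = solve 4 (λ a b c d → a :* (c :- d) :+ d :* (a :- b) := a :* c :- b :* d) ≡.refl

  open Identities using (sub-add; neg-sub; neg-sub-neg; sub-sub; +-sub; *-sub)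

  0<1 : 0ℚ < 1ℚ
  0<1 = ℚ.positive⁻¹ 1ℚ

  0<½ : 0ℚ < ½
  0<½ = ℚ.positive⁻¹ ½

private
  +∣-∣-pos : ∀ {δ} p → 0ℚ < δ → 0ℚ < δ ℚ.+ ∣ p ∣
  +∣-∣-pos p 0<δ = ℚ.+-mono-<-≤ 0<δ (ℚ.0≤∣p∣ p)

  ∣-∣-shift : ∀ {δ} p q → ∣ p ℚ.- q ∣ < δ → ∣ p ∣ < δ ℚ.+ ∣ q ∣
  ∣-∣-shift {δ} p q h = begin-strict
    ∣ p ∣                       ≡⟨ ≡.cong ∣_∣ (sub-add p q) ⟩
    ∣ p ℚ.- q ℚ.+ q ∣           ≤⟨ ℚ.∣p+q∣≤∣p∣+∣q∣ (p ℚ.- q) q ⟩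
    ∣ p ℚ.- q ∣ ℚ.+ ∣ q ∣       <⟨ ℚ.+-monoˡ-< ∣ q ∣ h ⟩
    δ ℚ.+ ∣ q ∣                 ∎
    where open ℚ.≤-Reasoning

abstract
  null-cong : ∀ {u v} → (∀ m n → u m n ≡ v m n) → Null u → Null v
  null-cong {u} {v} u≡v (mkNull nu) = mkNull go
    where
    go : ∀ ε → 0ℚ < ε → ∃ λ N → ∀ m n → N ℕ.≤ m → N ℕ.≤ n → ∣ v m n ∣ < ε
    go ε 0<ε with nu ε 0<ε
    ... | N , h = N , λ m n p q → ≡.subst (λ t → ∣ t ∣ < ε) (u≡v m n) (h m n p q)

  null-0 : Null (λ _ _ → 0ℚ)
  null-0 = mkNull (λ ε 0<ε → 0 , λ _ _ _ _ → 0<ε)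

  null-+ : ∀ {u v} → Null u → Null v → Null (λ m n → u m n ℚ.+ v m n)
  null-+ {u} {v} (mkNull nu) (mkNull nv) = mkNull go
    where
    open ℚ.≤-Reasoning
    go : ∀ ε → 0ℚ < ε → ∃ λ N → ∀ m n → N ℕ.≤ m → N ℕ.≤ n → ∣ u m n ℚ.+ v m n ∣ < ε
    go ε 0<ε with nu (½ ℚ.* ε) (*-pos 0<½ 0<ε) | nv (½ ℚ.* ε) (*-pos 0<½ 0<ε)
    ... | M , h | N , k = M ℕ.⊔ N , λ m n p q → begin-strict
      ∣ u m n ℚ.+ v m n ∣
        ≤⟨ ℚ.∣p+q∣≤∣p∣+∣q∣ (u m n) (v m n) ⟩
      ∣ u m n ∣ ℚ.+ ∣ v m n ∣
        <⟨ ℚ.+-mono-< (h m n (ℕ.m⊔n≤o⇒m≤o M N p) (ℕ.m⊔n≤o⇒m≤o M N q))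
                      (k m n (ℕ.m⊔n≤o⇒n≤o M N p) (ℕ.m⊔n≤o⇒n≤o M N q)) ⟩
      ½ ℚ.* ε ℚ.+ ½ ℚ.* ε
        ≡⟨ halves ε ⟩
      ε ∎

  null-neg : ∀ {u} → Null u → Null (λ m n → ℚ.- u m n)
  null-neg {u} (mkNull nu) = mkNull go
    where
    go : ∀ ε → 0ℚ < ε → ∃ λ N → ∀ m n → N ℕ.≤ m → N ℕ.≤ n → ∣ ℚ.- u m n ∣ < ε
    go ε 0<ε with nu ε 0<ε
    ... | N , h = N , λ m n p q → ≡.subst (_< ε) (≡.sym (ℚ.∣-p∣≡∣p∣ (u m n))) (h m n p q)

  null-* : ∀ {u v} → Bounded u → Null v → Null (λ m n → u m n ℚ.* v m n)
  null-* {u} {v} (mkBounded B 0<B M h) (mkNull nv) = mkNull go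
    where
    open ℚ.≤-Reasoning
    instance
      posB : ℚ.Positive B
      posB = ℚ.positive 0<B
      nonZeroB : ℚ.NonZero B
      nonZeroB = ℚ.pos⇒nonZero B
    go : ∀ ε → 0ℚ < ε → ∃ λ N → ∀ m n → N ℕ.≤ m → N ℕ.≤ n → ∣ u m n ℚ.* v m n ∣ < ε
    go ε 0<ε with nv (1/ B ℚ.* ε) (*-pos (ℚ.positive⁻¹ (1/ B) {{ℚ.1/pos⇒pos B}}) 0<ε)
    ... | N , k = M ℕ.⊔ N , λ m n p q → begin-strict
      ∣ u m n ℚ.* v m n ∣
        ≡⟨ ℚ.∣p*q∣≡∣p∣*∣q∣ (u m n) (v m n) ⟩
      ∣ u m n ∣ ℚ.* ∣ v m n ∣
        ≤⟨ ℚ.*-monoʳ-≤-nonNeg ∣ v m n ∣ {{ℚ.∣-∣-nonNeg (v m n)}}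
             (ℚ.<⇒≤ (h m n (ℕ.m⊔n≤o⇒m≤o M N p) (ℕ.m⊔n≤o⇒m≤o M N q))) ⟩
      B ℚ.* ∣ v m n ∣
        <⟨ ℚ.*-monoʳ-<-pos B (k m n (ℕ.m⊔n≤o⇒n≤o M N p) (ℕ.m⊔n≤o⇒n≤o M N q)) ⟩
      B ℚ.* (1/ B ℚ.* ε)
        ≡⟨ ℚ.*-assoc B (1/ B) ε ⟨
      B ℚ.* 1/ B ℚ.* ε
        ≡⟨ ≡.cong (ℚ._* ε) (ℚ.*-inverseʳ B) ⟩
      1ℚ ℚ.* ε
        ≡⟨ ℚ.*-identityˡ ε ⟩
      ε ∎

-- Cauchy sequences of rationals; two of them are equal as real numbers
-- (_≈ᵣ_) when their difference tends to 0.  With eta, conversion checking would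
-- compare the cauchy proofs, which is prohibitively slow.
record ℝ : Set where
  no-eta-equality
  field
    seq    : ℕ → ℚ
    cauchy : Null (λ m n → seq m ℚ.- seq n)

open ℝ public

infix 4 _≈ᵣ_
record _≈ᵣ_ (x y : ℝ) : Set where
  no-eta-equality
  pattern
  constructor mk≈
  field null : Null (λ n _ → seq x n ℚ.- seq y n)

open _≈ᵣ_ public

pointwise⇒≈ᵣ : ∀ {x y} → (∀ n → seq x n ≡ seq y n) → x ≈ᵣ y
pointwise⇒≈ᵣ {x} {y} h = mk≈ (null-cong
  (λ n _ → ≡.sym (≡.trans (≡.cong (ℚ._- seq y n) (h n)) (ℚ.+-inverseʳ (seq y n)))) null-0)

abstract
  bounded : ∀ x → Bounded (λ m _ → seq x m)
  bounded x = go 1ℚ 0<1 (Null.tail (cauchy x) 1ℚ 0<1)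
    where
    go : ∀ δ → 0ℚ < δ →
         (∃ λ N → ∀ m n → N ℕ.≤ m → N ℕ.≤ n → ∣ seq x m ℚ.- seq x n ∣ < δ) →
         Bounded (λ m _ → seq x m)
    go δ 0<δ (N , h) = mkBounded (δ ℚ.+ ∣ seq x N ∣) (+∣-∣-pos (seq x N) 0<δ) N
      (λ m _ p _ → ∣-∣-shift (seq x m) (seq x N) (h m N p ℕ.≤-refl))

private
  swap : ∀ {u} → Bounded u → Bounded (λ m n → u n m)
  swap (mkBounded B 0<B N h) = mkBounded B 0<B N (λ m n p q → h n m q p)

infix  8 -ᵣ_
infixl 7 _*ᵣ_
infixl 6 _+ᵣ_

fromℚ : ℚ → ℝ
seq    (fromℚ q) _ = q
cauchy (fromℚ q)   = null-cong (λ _ _ → ≡.sym (ℚ.+-inverseʳ q)) null-0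

_+ᵣ_ : ℝ → ℝ → ℝ
seq    (x +ᵣ y) n = seq x n ℚ.+ seq y n
cauchy (x +ᵣ y)   = null-cong
  (λ m n → +-sub (seq x m) (seq x n) (seq y m) (seq y n))
  (null-+ (cauchy x) (cauchy y))

-ᵣ_ : ℝ → ℝ
seq    (-ᵣ x) n = ℚ.- seq x n
cauchy (-ᵣ x)   = null-cong
  (λ m n → neg-sub-neg (seq x m) (seq x n))
  (null-neg (cauchy x))

_*ᵣ_ : ℝ → ℝ → ℝ
seq    (x *ᵣ y) n = seq x n ℚ.* seq y n
cauchy (x *ᵣ y)   = null-cong
  (λ m n → *-sub (seq x m) (seq x n) (seq y m) (seq y n))
  (null-+ (null-* (bounded x) (cauchy y)) (null-* (swap (bounded y)) (cauchy x)))

≈ᵣ-isEquivalence : IsEquivalence _≈ᵣ_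
≈ᵣ-isEquivalence = record
  { refl  = pointwise⇒≈ᵣ (λ _ → ≡.refl)
  ; sym   = λ {x} {y} x≈y → mk≈ (null-cong
      (λ n _ → neg-sub (seq x n) (seq y n))
      (null-neg (null x≈y)))
  ; trans = λ {x} {y} {z} x≈y y≈z → mk≈ (null-cong
      (λ n _ → sub-sub (seq x n) (seq y n) (seq z n))
      (null-+ (null x≈y) (null y≈z)))
  }

+ᵣ-cong : ∀ {x y u v} → x ≈ᵣ y → u ≈ᵣ v → x +ᵣ u ≈ᵣ y +ᵣ v
+ᵣ-cong {x} {y} {u} {v} x≈y u≈v = mk≈ (null-cong
  (λ n _ → +-sub (seq x n) (seq y n) (seq u n) (seq v n))
  (null-+ (null x≈y) (null u≈v)))

*ᵣ-cong : ∀ {x y u v} → x ≈ᵣ y → u ≈ᵣ v → x *ᵣ u ≈ᵣ y *ᵣ v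
*ᵣ-cong {x} {y} {u} {v} x≈y u≈v = mk≈ (null-cong
  (λ n _ → *-sub (seq x n) (seq y n) (seq u n) (seq v n))
  (null-+ (null-* (bounded x) (null u≈v)) (null-* (bounded v) (null x≈y))))

-ᵣ-cong : ∀ {x y} → x ≈ᵣ y → -ᵣ x ≈ᵣ -ᵣ y
-ᵣ-cong {x} {y} x≈y = mk≈ (null-cong
  (λ n _ → neg-sub-neg (seq x n) (seq y n))
  (null-neg (null x≈y)))

private
  +-assocᵣ : ∀ x y z → (x +ᵣ y) +ᵣ z ≈ᵣ x +ᵣ (y +ᵣ z)
  +-assocᵣ x y z = pointwise⇒≈ᵣ (λ n → ℚ.+-assoc (seq x n) (seq y n) (seq z n))

  +-commᵣ : ∀ x y → x +ᵣ y ≈ᵣ y +ᵣ x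
  +-commᵣ x y = pointwise⇒≈ᵣ (λ n → ℚ.+-comm (seq x n) (seq y n))

  +-identityˡᵣ : ∀ x → fromℚ 0ℚ +ᵣ x ≈ᵣ x
  +-identityˡᵣ x = pointwise⇒≈ᵣ (λ n → ℚ.+-identityˡ (seq x n))

  +-identityʳᵣ : ∀ x → x +ᵣ fromℚ 0ℚ ≈ᵣ x
  +-identityʳᵣ x = pointwise⇒≈ᵣ (λ n → ℚ.+-identityʳ (seq x n))

  +-inverseˡᵣ : ∀ x → -ᵣ x +ᵣ x ≈ᵣ fromℚ 0ℚ
  +-inverseˡᵣ x = pointwise⇒≈ᵣ (λ n → ℚ.+-inverseˡ (seq x n))

  +-inverseʳᵣ : ∀ x → x +ᵣ -ᵣ x ≈ᵣ fromℚ 0ℚ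
  +-inverseʳᵣ x = pointwise⇒≈ᵣ (λ n → ℚ.+-inverseʳ (seq x n))

  *-assocᵣ : ∀ x y z → (x *ᵣ y) *ᵣ z ≈ᵣ x *ᵣ (y *ᵣ z)
  *-assocᵣ x y z = pointwise⇒≈ᵣ (λ n → ℚ.*-assoc (seq x n) (seq y n) (seq z n))

  *-commᵣ : ∀ x y → x *ᵣ y ≈ᵣ y *ᵣ x
  *-commᵣ x y = pointwise⇒≈ᵣ (λ n → ℚ.*-comm (seq x n) (seq y n))

  *-identityˡᵣ : ∀ x → fromℚ 1ℚ *ᵣ x ≈ᵣ x
  *-identityˡᵣ x = pointwise⇒≈ᵣ (λ n → ℚ.*-identityˡ (seq x n))

  *-identityʳᵣ : ∀ x → x *ᵣ fromℚ 1ℚ ≈ᵣ x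
  *-identityʳᵣ x = pointwise⇒≈ᵣ (λ n → ℚ.*-identityʳ (seq x n))

  *-distribˡᵣ : ∀ x y z → x *ᵣ (y +ᵣ z) ≈ᵣ (x *ᵣ y) +ᵣ (x *ᵣ z)
  *-distribˡᵣ x y z = pointwise⇒≈ᵣ (λ n → ℚ.*-distribˡ-+ (seq x n) (seq y n) (seq z n))

  *-distribʳᵣ : ∀ x y z → (y +ᵣ z) *ᵣ x ≈ᵣ (y *ᵣ x) +ᵣ (z *ᵣ x)
  *-distribʳᵣ x y z = pointwise⇒≈ᵣ (λ n → ℚ.*-distribʳ-+ (seq x n) (seq y n) (seq z n))

ℝ-commutativeRing : CommutativeRing 0ℓ 0ℓ
ℝ-commutativeRing = record
  { Carrier = ℝ ; _≈_ = _≈ᵣ_ ; _+_ = _+ᵣ_ ; _*_ = _*ᵣ_ ; -_ = -ᵣ_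
  ; 0# = fromℚ 0ℚ ; 1# = fromℚ 1ℚ
  ; isCommutativeRing = record
    { isRing = record
      { +-isAbelianGroup = record
        { isGroup = record
          { isMonoid = record
            { isSemigroup = record
              { isMagma = record { isEquivalence = ≈ᵣ-isEquivalence ; ∙-cong = +ᵣ-cong }
              ; assoc   = +-assocᵣ
              }
            ; identity = +-identityˡᵣ , +-identityʳᵣ
            }
          ; inverse = +-inverseˡᵣ , +-inverseʳᵣ
          ; ⁻¹-cong = -ᵣ-cong
          }
        ; comm = +-commᵣ
        }
      ; *-cong     = *ᵣ-cong
      ; *-assoc    = *-assocᵣ
      ; *-identity = *-identityˡᵣ , *-identityʳᵣ
      ; distrib    = *-distribˡᵣ , *-distribʳᵣ
      }
    ; *-comm = *-commᵣ
    }
  }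

-- R[i] = R[t]/(t² + 1); the ring laws are reduced to semiring
-- identities by writing - x as - 1# * x.
module AdjoinI {c ℓ} (R : CommutativeRing c ℓ) where

  open CommutativeRing R
  open import Algebra.Properties.Ring ring using (-1*x≈-x)
  open import Algebra.Solver.Ring.NaturalCoefficients.Default commutativeSemiring
    using (solve; _:+_; _:*_; _:=_)

  infix 5 _+i_
  record R[i] : Set c where
    constructor _+i_
    field
      re im : Carrier

  open R[i] public

  infix 4 _≈ᵢ_
  record _≈ᵢ_ (z w : R[i]) : Set ℓ where
    constructor _,_
    field
      re≈ : re z ≈ re w
      im≈ : im z ≈ im w

  open _≈ᵢ_ public

  infix  8 -ᵢ_
  infixl 7 _*ᵢ_
  infixl 6 _+ᵢ_

  _+ᵢ_ _*ᵢ_ : R[i] → R[i] → R[i]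
  (a +i b) +ᵢ (c +i d) = a + c +i b + d
  (a +i b) *ᵢ (c +i d) = a * c - b * d +i a * d + b * c

  -ᵢ_ : R[i] → R[i]
  -ᵢ (a +i b) = - a +i - b

  0ᵢ 1ᵢ : R[i]
  0ᵢ = 0# +i 0#
  1ᵢ = 1# +i 0#

  private
    minus : ∀ x y → x - y ≈ x + - 1# * y
    minus x y = +-congˡ (sym (-1*x≈-x y))

    minus-cong : ∀ {x x′ y y′} → x ≈ x′ → y ≈ y′ → x - y ≈ x′ - y′
    minus-cong p q = +-cong p (-‿cong q)

    x-0≈x : ∀ {x y} → y ≈ 0# → x - y ≈ x
    x-0≈x {x} {y} y≈0 = trans (minus x y)
      (trans (+-congˡ (trans (*-congˡ y≈0) (zeroʳ _))) (+-identityʳ x))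

    *-comm-ᵢ : ∀ z w → z *ᵢ w ≈ᵢ w *ᵢ z
    *-comm-ᵢ (a +i b) (c +i d) =
      minus-cong (*-comm a c) (*-comm b d) ,
      trans (+-comm _ _) (+-cong (*-comm b c) (*-comm a d))

    *-assoc-ᵢ : ∀ z w v → (z *ᵢ w) *ᵢ v ≈ᵢ z *ᵢ (w *ᵢ v)
    *-assoc-ᵢ (a +i b) (c +i d) (e +i f) =
      trans (minus _ _) (trans (+-congʳ (*-congʳ (minus _ _))) (trans
        (solve 7 (λ n a b c d e f →
           (a :* c :+ n :* (b :* d)) :* e :+ n :* ((a :* d :+ b :* c) :* f) :=
           a :* (c :* e :+ n :* (d :* f)) :+ n :* (b :* (c :* f :+ d :* e)))
           refl (- 1#) a b c d e f)
        (sym (trans (minus _ _) (+-congʳ (*-congˡ (minus _ _))))))) ,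
      trans (+-congʳ (*-congʳ (minus _ _))) (trans
        (solve 7 (λ n a b c d e f →
           (a :* c :+ n :* (b :* d)) :* f :+ (a :* d :+ b :* c) :* e :=
           a :* (c :* f :+ d :* e) :+ b :* (c :* e :+ n :* (d :* f)))
           refl (- 1#) a b c d e f)
        (sym (+-congˡ (*-congˡ (minus _ _)))))

    *-distribˡ-ᵢ : ∀ z w v → (z *ᵢ (w +ᵢ v)) ≈ᵢ (z *ᵢ w) +ᵢ (z *ᵢ v)
    *-distribˡ-ᵢ (a +i b) (c +i d) (e +i f) =
      trans (minus _ _) (trans
        (solve 7 (λ n a b c d e f →
           a :* (c :+ e) :+ n :* (b :* (d :+ f)) :=
           (a :* c :+ n :* (b :* d)) :+ (a :* e :+ n :* (b :* f)))
           refl (- 1#) a b c d e f)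
        (sym (+-cong (minus _ _) (minus _ _)))) ,
      solve 6 (λ a b c d e f →
         a :* (d :+ f) :+ b :* (c :+ e) :=
         (a :* d :+ b :* c) :+ (a :* f :+ b :* e))
         refl a b c d e f

    *-identityˡ-ᵢ : ∀ z → 1ᵢ *ᵢ z ≈ᵢ z
    *-identityˡ-ᵢ (a +i b) =
      trans (x-0≈x (zeroˡ b)) (*-identityˡ a) ,
      trans (+-cong (*-identityˡ b) (zeroˡ a)) (+-identityʳ b)

    ≈ᵢ-trans : ∀ {z w v} → z ≈ᵢ w → w ≈ᵢ v → z ≈ᵢ v
    ≈ᵢ-trans (p , q) (p′ , q′) = trans p p′ , trans q q′

    +ᵢ-cong : ∀ {z z′ w w′} → z ≈ᵢ z′ → w ≈ᵢ w′ → (z +ᵢ w) ≈ᵢ (z′ +ᵢ w′)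
    +ᵢ-cong (p , q) (p′ , q′) = +-cong p p′ , +-cong q q′

  commutativeRing : CommutativeRing c ℓ
  commutativeRing = record
    { Carrier = R[i] ; _≈_ = _≈ᵢ_ ; _+_ = _+ᵢ_ ; _*_ = _*ᵢ_ ; -_ = -ᵢ_
    ; 0# = 0ᵢ ; 1# = 1ᵢ
    ; isCommutativeRing = record
      { isRing = record
        { +-isAbelianGroup = record
          { isGroup = record
            { isMonoid = record
              { isSemigroup = record
                { isMagma = record
                  { isEquivalence = record
                    { refl  = refl , refl
                    ; sym   = λ (p , q) → sym p , sym q
                    ; trans = ≈ᵢ-trans
                    }
                  ; ∙-cong = +ᵢ-cong
                  }
                ; assoc = λ _ _ _ → +-assoc _ _ _ , +-assoc _ _ _
                }
              ; identity = (λ _ → +-identityˡ _ , +-identityˡ _)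
                         , (λ _ → +-identityʳ _ , +-identityʳ _)
              }
            ; inverse = (λ _ → -‿inverseˡ _ , -‿inverseˡ _)
                      , (λ _ → -‿inverseʳ _ , -‿inverseʳ _)
            ; ⁻¹-cong = λ (p , q) → -‿cong p , -‿cong q
            }
          ; comm = λ _ _ → +-comm _ _ , +-comm _ _
          }
        ; *-cong = λ (p , q) (p′ , q′) →
            minus-cong (*-cong p p′) (*-cong q q′) ,
            +-cong (*-cong p q′) (*-cong q p′)
        ; *-assoc = *-assoc-ᵢ
        ; *-identity = *-identityˡ-ᵢ
                     , (λ z → ≈ᵢ-trans (*-comm-ᵢ z 1ᵢ) (*-identityˡ-ᵢ z))
        ; distrib = *-distribˡ-ᵢ
                  , (λ z w v → ≈ᵢ-trans (*-comm-ᵢ (w +ᵢ v) z)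
                      (≈ᵢ-trans (*-distribˡ-ᵢ z w v)
                        (+ᵢ-cong (*-comm-ᵢ z w) (*-comm-ᵢ z v))))
        }
      ; *-comm = *-comm-ᵢ
      }
    }

ℂ-commutativeRing : CommutativeRing 0ℓ 0ℓ
ℂ-commutativeRing = AdjoinI.commutativeRing ℝ-commutativeRing

ℂ : Set
ℂ = CommutativeRing.Carrier ℂ-commutativeRing

module Polynomials {c ℓ} (R : CommutativeRing c ℓ) (r : ℕ) where

  open CommutativeRing R

  -- A formal sum of terms (coefficient , exponents of z₁, …, z_r); the
  -- same monomial may occur several times, and _≈ₚ_ compares total coefficients.
  Poly : Set c
  Poly = List (Carrier × Vec ℕ r)

  coeff : Poly → Vec ℕ r → Carrier
  coeff []            e = 0#
  coeff ((a , d) ∷ p) e = (if does (≡-dec ℕ._≟_ d e) then a else 0#) + coeff p e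

  infix 4 _≈ₚ_
  _≈ₚ_ : Poly → Poly → Set ℓ
  p ≈ₚ q = ∀ e → coeff p e ≈ coeff q e

  infixl 7 _*ₚ_ _·ₚ_
  infixl 6 _+ₚ_

  0ₚ 1ₚ : Poly
  0ₚ = []
  1ₚ = (1# , Vec.replicate r 0) ∷ []

  _+ₚ_ _*ₚ_ : Poly → Poly → Poly
  _+ₚ_ = _++_
  _*ₚ_ = List.cartesianProductWith (λ (a , d) (b , e) → a * b , Vec.zipWith ℕ._+_ d e)

  _·ₚ_ : Carrier → Poly → Poly
  a ·ₚ p = List.map (map₁ (a *_)) p

  z : Fin r → Poly
  z j = (1# , Vec.replicate r 0 [ j ]≔ 1) ∷ []

  sumₚ : ∀ {n} → (Fin n → Poly) → Poly
  sumₚ = Vector.foldr _+ₚ_ 0ₚ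

  productₚ : List Poly → Poly
  productₚ = List.foldr _*ₚ_ 1ₚ

  -- Finite families are lists; the index set of ps is Fin (length ps), so
  -- repeated members carry separate coefficients.  (Over ℂ, where _≈_ is
  -- ¬¬-stable, this says that no nontrivial combination vanishes.)
  LinearlyIndependent : List Poly → Set (c ⊔ ℓ)
  LinearlyIndependent ps =
    (a : Fin (length ps) → Carrier) →
    sumₚ (λ i → a i ·ₚ lookup ps i) ≈ₚ 0ₚ →
    ∀ i → a i ≈ 0#

-- choose k (x₁ ∷ … ∷ x_l ∷ []) lists all (x_{i₁} ∷ … ∷ x_{i_k} ∷ []) with
-- i₁ < … < i_k, in lexicographic order of the indices.
choose : ∀ {a} {A : Set a} → ℕ → List A → List (List A)
choose zero    _        = [] ∷ []
choose (suc k) []       = []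
choose (suc k) (x ∷ xs) = List.map (x ∷_) (choose k xs) ++ choose (suc k) xs

module _ {r : ℕ} where

  open Polynomials ℂ-commutativeRing r

  linearForm : (Fin r → ℂ) → Poly
  linearForm a = sumₚ (λ j → a j ·ₚ z j)

  S₁ : ∀ {m} → (Fin m → Fin r → ℂ) → List Poly
  S₁ a = List.tabulate (λ j → z j *ₚ z j)
      ++ List.tabulate (λ i → linearForm (a i) *ₚ linearForm (a i))

  S : ∀ {m} → ℕ → (Fin m → Fin r → ℂ) → List Poly
  S k a = List.map productₚ (choose k (S₁ a))

{-# OPTIONS --safe #-}
module Submission where

-- Write A = aaᵀ and B = bbᵀ for the coefficient vectors a, b of f₁, f₂.
--
-- S₁ ⇒ S₂.  Independence of S₁ means that the off-diagonal parts of A and B are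
-- independent.  Polarising a relation
--   Σ c_pq z_p²z_q² + Σ u_p z_p²f₁² + Σ v_p z_p²f₂² + w f₁²f₂² = 0
-- gives one equation for each quadruple of indices; for the patterns iiii, iiij, iijk
-- it involves only u_i, v_i and w, for four distinct indices only w.  If w ≠ 0, these
-- equations imply a_i b_i a_j b_k = 0 for distinct i, j, k, and then that some nontrivial
-- combination of A and B is diagonal.  So w = 0; the same equations now give u = v = 0,
-- and the pattern iijj gives c = 0.
--
-- S₂ ⇒ S₁.  Let Σ u_i z_i² + v f₁² + w f₂² = 0.  If one of the coefficients vanishes,
-- then multiplying by the corresponding member of S₁ yields a relation between members
-- of S₂, so the other coefficients vanish too.  If none vanishes, then v A + w B is a diagonal
-- matrix of rank r, whence r = 2; and then multiples of the relation express the squares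
-- of the members of S₁ by S₂, which turns the identity
--   (f₁² - a₀²z₀² - a₁²z₁²)² = 4a₀²a₁²z₀²z₁²
-- into a nontrivial relation between members of S₂.

open import Defs
open import Algebra.Bundles using (CommutativeRing)
open import Data.Bool.Base using (true; false; if_then_else_)
open import Data.Empty using (⊥)
open import Data.Fin.Base as Fin using (Fin; zero; suc; _<_)
import Data.Fin.Properties as Fin
open import Data.List.Base as List
  using (List; []; _∷_; _++_; length; lookup; filter; tabulate; foldr; map)
open import Data.List.Properties using (length-filter)
open import Data.Nat.Base as ℕ using (ℕ; zero; suc; _≤_; z<s; s<s)
import Data.Nat.Properties as ℕ
open import Data.Product.Base using (_×_; _,_; proj₁; proj₂; ∃)
open import Data.Rational.Base as ℚ using (ℚ; 0ℚ; 1ℚ; ½; ∣_∣)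
import Data.Rational.Properties as ℚ
open import Data.Rational.Solver using (module +-*-Solver)
open import Data.Sum.Base using (inj₁; inj₂)
open import Data.Unit.Polymorphic.Base using (⊤; tt)
open import Data.Vec.Base as Vec using (Vec; []; _∷_; _[_]≔_)
open import Data.Vec.Properties using (≡-dec)
open import Function.Base using (_∘_)
open import Function.Bundles using (_⇔_; mk⇔)
open import Level using (Level; _⊔_)
open import Relation.Binary.PropositionalEquality.Core as ≡ using (_≡_; _≢_)
open import Relation.Nullary.Decidable using (does; yes; no; ¬?; from-no)
open import Relation.Nullary.Negation using (¬_; contradiction)

-- Linear functionals on polynomials

module Functionals {c ℓ} (R : CommutativeRing c ℓ) (r : ℕ) where

  open CommutativeRing R hiding (zero)
  open Polynomials R r
  open import Algebra.Properties.CommutativeSemigroup +-commutativeSemigroup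
    using () renaming (interchange to +-interchange; x∙yz≈y∙xz to +-leftComm)
  open import Algebra.Properties.CommutativeSemigroup *-commutativeSemigroup
    using () renaming (interchange to *-interchange; x∙yz≈y∙xz to *-leftComm)
  open import Algebra.Properties.Semiring.Sum semiring
    using (sum)
  open import Algebra.Properties.Semiring.Exp semiring using (_^_; ^-homo-*)
  open import Relation.Binary.Reasoning.Setoid setoid

  -- The linear functional with value `φ d` on the monomial with exponents `d`. Extracting a
  -- coefficient, evaluating at a point, polarising and multiplying by a fixed polynomial all take
  -- this form, so a relation between polynomials can be handled as a family of scalar equations.
  ⟪_⟫ : (Vec ℕ r → Carrier) → Poly → Carrier
  ⟪ φ ⟫ []            = 0#
  ⟪ φ ⟫ ((a , d) ∷ p) = a * φ d + ⟪ φ ⟫ p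

  ⟪⟫-cong : ∀ {φ ψ} → (∀ d → φ d ≈ ψ d) → ∀ p → ⟪ φ ⟫ p ≈ ⟪ ψ ⟫ p
  ⟪⟫-cong φ≈ψ []            = refl
  ⟪⟫-cong φ≈ψ ((a , d) ∷ p) = +-cong (*-congˡ (φ≈ψ d)) (⟪⟫-cong φ≈ψ p)

  ⟪⟫-zero : ∀ {φ} → (∀ d → φ d ≈ 0#) → ∀ p → ⟪ φ ⟫ p ≈ 0#
  ⟪⟫-zero φ≈0 []            = refl
  ⟪⟫-zero φ≈0 ((a , d) ∷ p) =
    trans (+-cong (trans (*-congˡ (φ≈0 d)) (zeroʳ a)) (⟪⟫-zero φ≈0 p)) (+-identityʳ 0#)

  ⟪⟫-+ : ∀ φ ψ p → ⟪ (λ d → φ d + ψ d) ⟫ p ≈ ⟪ φ ⟫ p + ⟪ ψ ⟫ p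
  ⟪⟫-+ φ ψ []            = sym (+-identityʳ 0#)
  ⟪⟫-+ φ ψ ((a , d) ∷ p) =
    trans (+-cong (distribˡ a (φ d) (ψ d)) (⟪⟫-+ φ ψ p)) (+-interchange _ _ _ _)

  ⟪⟫-* : ∀ b φ p → ⟪ (λ d → b * φ d) ⟫ p ≈ b * ⟪ φ ⟫ p
  ⟪⟫-* b φ []            = sym (zeroʳ b)
  ⟪⟫-* b φ ((a , d) ∷ p) =
    trans (+-cong (*-leftComm a b (φ d)) (⟪⟫-* b φ p)) (sym (distribˡ b _ _))

  ⟪⟫-++ : ∀ φ p q → ⟪ φ ⟫ (p +ₚ q) ≈ ⟪ φ ⟫ p + ⟪ φ ⟫ q
  ⟪⟫-++ φ []            q = sym (+-identityˡ _)
  ⟪⟫-++ φ ((a , d) ∷ p) q = trans (+-congˡ (⟪⟫-++ φ p q)) (sym (+-assoc _ _ _))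

  ⟪⟫-· : ∀ φ a p → ⟪ φ ⟫ (a ·ₚ p) ≈ a * ⟪ φ ⟫ p
  ⟪⟫-· φ a []            = sym (zeroʳ a)
  ⟪⟫-· φ a ((b , d) ∷ p) =
    trans (+-cong (*-assoc a b (φ d)) (⟪⟫-· φ a p)) (sym (distribˡ a _ _))

  ⟪⟫-sumₚ : ∀ φ {n} (p : Fin n → Poly) → ⟪ φ ⟫ (sumₚ p) ≈ sum (λ i → ⟪ φ ⟫ (p i))
  ⟪⟫-sumₚ φ {zero}  p = refl
  ⟪⟫-sumₚ φ {suc n} p = trans (⟪⟫-++ φ (p zero) _) (+-congˡ (⟪⟫-sumₚ φ (p ∘ suc)))

  infixl 6 _⊕_
  _⊕_ : Vec ℕ r → Vec ℕ r → Vec ℕ r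
  _⊕_ = Vec.zipWith ℕ._+_

  -- For fixed `q`, the map sending `p` to `⟪ φ ⟫ (p *ₚ q)` is again one of the functionals. This is
  -- what allows a relation to be multiplied by a polynomial.
  ⟪⟫-*ₚ : ∀ φ p q → ⟪ φ ⟫ (p *ₚ q) ≈ ⟪ (λ d → ⟪ (λ e → φ (d ⊕ e)) ⟫ q) ⟫ p
  ⟪⟫-*ₚ φ []            q = refl
  ⟪⟫-*ₚ φ ((a , d) ∷ p) q = trans (⟪⟫-++ φ (scale q) (p *ₚ q)) (+-cong (term q) (⟪⟫-*ₚ φ p q))
    where
    scale : Poly → Poly
    scale = List.map (λ (b , e) → a * b , d ⊕ e)
    term : ∀ q → ⟪ φ ⟫ (scale q) ≈ a * ⟪ (λ e → φ (d ⊕ e)) ⟫ q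
    term []            = sym (zeroʳ a)
    term ((b , e) ∷ q) = trans (+-cong (*-assoc a b _) (term q)) (sym (distribˡ a _ _))

  ⟪⟫-swap : ∀ (φ : Vec ℕ r → Vec ℕ r → Carrier) p q →
    ⟪ (λ d → ⟪ φ d ⟫ q) ⟫ p ≈ ⟪ (λ e → ⟪ (λ d → φ d e) ⟫ p) ⟫ q
  ⟪⟫-swap φ []            q = sym (⟪⟫-zero (λ _ → refl) q)
  ⟪⟫-swap φ ((a , d) ∷ p) q = begin
    a * ⟪ φ d ⟫ q + ⟪ (λ d → ⟪ φ d ⟫ q) ⟫ p
      ≈⟨ +-cong (⟪⟫-* a (φ d) q) (sym (⟪⟫-swap φ p q)) ⟨
    ⟪ (λ e → a * φ d e) ⟫ q + ⟪ (λ e → ⟪ (λ d → φ d e) ⟫ p) ⟫ q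
      ≈⟨ ⟪⟫-+ _ _ q ⟨
    ⟪ (λ e → a * φ d e + ⟪ (λ d → φ d e) ⟫ p) ⟫ q ∎

  indicator : Vec ℕ r → Vec ℕ r → Carrier
  indicator e d = if does (≡-dec ℕ._≟_ d e) then 1# else 0#

  coeff≈ : ∀ p e → coeff p e ≈ ⟪ indicator e ⟫ p
  coeff≈ []            e = refl
  coeff≈ ((a , d) ∷ p) e = +-cong term (coeff≈ p e)
    where
    term : (if does (≡-dec ℕ._≟_ d e) then a else 0#) ≈ a * indicator e d
    term with does (≡-dec ℕ._≟_ d e)
    ... | true  = sym (*-identityʳ a)
    ... | false = sym (zeroʳ a)

  private
    remove : Vec ℕ r → Poly → Poly
    remove d = filter (λ t → ¬? (≡-dec ℕ._≟_ (proj₂ t) d))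

    ⟪⟫-remove : ∀ φ d p → ⟪ φ ⟫ p ≈ coeff p d * φ d + ⟪ φ ⟫ (remove d p)
    ⟪⟫-remove φ d [] = sym (trans (+-identityʳ _) (zeroˡ (φ d)))
    ⟪⟫-remove φ d ((a , e) ∷ p) with ≡-dec ℕ._≟_ e d
    ... | yes ≡.refl = begin
      a * φ e + ⟪ φ ⟫ p                                       ≈⟨ +-congˡ (⟪⟫-remove φ e p) ⟩
      a * φ e + (coeff p e * φ e + ⟪ φ ⟫ (remove e p))        ≈⟨ +-assoc _ _ _ ⟨
      a * φ e + coeff p e * φ e + ⟪ φ ⟫ (remove e p)          ≈⟨ +-congʳ (distribʳ (φ e) a _) ⟨
      (a + coeff p e) * φ e + ⟪ φ ⟫ (remove e p)              ∎
    ... | no _ = begin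
      a * φ e + ⟪ φ ⟫ p                                       ≈⟨ +-congˡ (⟪⟫-remove φ d p) ⟩
      a * φ e + (coeff p d * φ d + ⟪ φ ⟫ (remove d p))        ≈⟨ +-leftComm _ _ _ ⟩
      coeff p d * φ d + (a * φ e + ⟪ φ ⟫ (remove d p))        ≈⟨ +-congʳ (*-congʳ (+-identityˡ _)) ⟨
      (0# + coeff p d) * φ d + (a * φ e + ⟪ φ ⟫ (remove d p)) ∎

    remove-vanishing : ∀ d p → p ≈ₚ 0ₚ → remove d p ≈ₚ 0ₚ
    remove-vanishing d p p≈0 e = trans (coeff≈ (remove d p) e) vanish
      where
      0≈ : 0# ≈ coeff p d * indicator e d + ⟪ indicator e ⟫ (remove d p)
      0≈ = trans (sym (p≈0 e)) (trans (coeff≈ p e) (⟪⟫-remove (indicator e) d p))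
      vanish : ⟪ indicator e ⟫ (remove d p) ≈ 0#
      vanish = begin
        ⟪ indicator e ⟫ (remove d p)
          ≈⟨ +-identityˡ _ ⟨
        0# + ⟪ indicator e ⟫ (remove d p)
          ≈⟨ +-congʳ (trans (*-congʳ (p≈0 d)) (zeroˡ _)) ⟨
        coeff p d * indicator e d + ⟪ indicator e ⟫ (remove d p)
          ≈⟨ 0≈ ⟨
        0# ∎

    -- Collecting all terms with the exponents `d` of the first term splits off `coeff p d * φ d`,
    -- which is zero, and leaves a formal sum that still vanishes. The recursion runs on a bound for
    -- the length because `remove d p` is not a subterm of `p`.
    ⟪⟫-vanishing′ : ∀ n φ p → length p ℕ.≤ n → p ≈ₚ 0ₚ → ⟪ φ ⟫ p ≈ 0#
    ⟪⟫-vanishing′ _       φ []              _       _   = refl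
    ⟪⟫-vanishing′ (suc n) φ p@((a , d) ∷ q) (ℕ.s≤s l) p≈0 = begin
      ⟪ φ ⟫ p                                 ≈⟨ ⟪⟫-remove φ d p ⟩
      coeff p d * φ d + ⟪ φ ⟫ (remove d p)    ≈⟨ +-congʳ (trans (*-congʳ (p≈0 d)) (zeroˡ _)) ⟩
      0# + ⟪ φ ⟫ (remove d p)                 ≈⟨ +-identityˡ _ ⟩
      ⟪ φ ⟫ (remove d p)                      ≈⟨ ⟪⟫-vanishing′ n φ (remove d p) shorter
                                                   (remove-vanishing d p p≈0) ⟩
      0#                                      ∎
      where
      shorter : length (remove d p) ℕ.≤ n
      -- The first term has exponents `d` and is itself removed, so the length drops strictly.
      shorter with ≡-dec ℕ._≟_ d d
      ... | yes _  = ℕ.≤-trans (length-filter _ q) l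
      ... | no d≢d = contradiction ≡.refl d≢d

  ⟪⟫-vanishing : ∀ φ p → p ≈ₚ 0ₚ → ⟪ φ ⟫ p ≈ 0#
  ⟪⟫-vanishing φ p = ⟪⟫-vanishing′ (length p) φ p ℕ.≤-refl

  -- The factor 1ₚ comes from productₚ.
  ⟪_⟫₂ : (Vec ℕ r → Carrier) → Poly → Poly → Carrier
  ⟪ φ ⟫₂ p q = ⟪ φ ⟫ (p *ₚ (q *ₚ 1ₚ))

  ⊕-identityʳ : ∀ {n} (d : Vec ℕ n) → Vec.zipWith ℕ._+_ d (Vec.replicate n 0) ≡ d
  ⊕-identityʳ []      = ≡.refl
  ⊕-identityʳ (x ∷ d) = ≡.cong₂ _∷_ (ℕ.+-identityʳ x) (⊕-identityʳ d)

  ⊕-comm : ∀ {n} (d e : Vec ℕ n) → Vec.zipWith ℕ._+_ d e ≡ Vec.zipWith ℕ._+_ e d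
  ⊕-comm []      []      = ≡.refl
  ⊕-comm (x ∷ d) (y ∷ e) = ≡.cong₂ _∷_ (ℕ.+-comm x y) (⊕-comm d e)

  reflexive-at : ∀ (φ : Vec ℕ r → Carrier) {d e} → d ≡ e → φ d ≈ φ e
  reflexive-at φ ≡.refl = refl

  ⟪⟫-*1 : ∀ φ p → ⟪ φ ⟫ (p *ₚ 1ₚ) ≈ ⟪ φ ⟫ p
  ⟪⟫-*1 φ p = trans (⟪⟫-*ₚ φ p 1ₚ) (⟪⟫-cong (λ d →
    trans (+-identityʳ _) (trans (*-identityˡ _) (reflexive-at φ (⊕-identityʳ d)))) p)

  ⟪⟫₂≈ : ∀ φ p q → ⟪ φ ⟫₂ p q ≈ ⟪ (λ d → ⟪ (λ e → φ (d ⊕ e)) ⟫ q) ⟫ p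
  ⟪⟫₂≈ φ p q = trans (⟪⟫-*ₚ φ p _) (⟪⟫-cong (λ d → ⟪⟫-*1 _ q) p)

  ⟪⟫₂-comm : ∀ φ p q → ⟪ φ ⟫₂ p q ≈ ⟪ φ ⟫₂ q p
  ⟪⟫₂-comm φ p q = begin
    ⟪ φ ⟫₂ p q                                       ≈⟨ ⟪⟫₂≈ φ p q ⟩
    ⟪ (λ d → ⟪ (λ e → φ (d ⊕ e)) ⟫ q) ⟫ p            ≈⟨ ⟪⟫-swap _ p q ⟩
    ⟪ (λ e → ⟪ (λ d → φ (d ⊕ e)) ⟫ p) ⟫ q            ≈⟨ ⟪⟫-cong (λ e → ⟪⟫-cong (λ d →
                                                          reflexive-at φ (⊕-comm d e)) p) q ⟩
    ⟪ (λ e → ⟪ (λ d → φ (e ⊕ d)) ⟫ p) ⟫ q            ≈⟨ ⟪⟫₂≈ φ q p ⟨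
    ⟪ φ ⟫₂ q p                                       ∎

  monomial : ∀ {n} → (Fin n → Carrier) → Vec ℕ n → Carrier
  monomial x []      = 1#
  monomial x (k ∷ d) = x zero ^ k * monomial (x ∘ suc) d

  monomial-⊕ : ∀ {n} (x : Fin n → Carrier) d e →
    monomial x (Vec.zipWith ℕ._+_ d e) ≈ monomial x d * monomial x e
  monomial-⊕ x []      []      = sym (*-identityˡ 1#)
  monomial-⊕ x (k ∷ d) (l ∷ e) =
    trans (*-cong (^-homo-* (x zero) k l) (monomial-⊕ (x ∘ suc) d e)) (*-interchange _ _ _ _)

  monomial-0 : ∀ {n} (x : Fin n → Carrier) → monomial x (Vec.replicate n 0) ≈ 1#
  monomial-0 {zero}  x = refl
  monomial-0 {suc n} x = trans (*-identityˡ _) (monomial-0 (x ∘ suc))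

  monomial-1 : ∀ {n} (x : Fin n → Carrier) j →
    monomial x (Vec.replicate n 0 [ j ]≔ 1) ≈ x j
  monomial-1 x zero    = trans (*-cong (*-identityʳ _) (monomial-0 (x ∘ suc))) (*-identityʳ _)
  monomial-1 x (suc j) = trans (*-identityˡ _) (monomial-1 (x ∘ suc) j)

  eval : (Fin r → Carrier) → Poly → Carrier
  eval x = ⟪ monomial x ⟫

  eval-* : ∀ x p q → eval x (p *ₚ q) ≈ eval x p * eval x q
  eval-* x p q = begin
    eval x (p *ₚ q)
      ≈⟨ ⟪⟫-*ₚ _ p q ⟩
    ⟪ (λ d → ⟪ (λ e → monomial x (d ⊕ e)) ⟫ q) ⟫ p
      ≈⟨ ⟪⟫-cong (λ d → trans (⟪⟫-cong (monomial-⊕ x d) q)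
           (trans (⟪⟫-* (monomial x d) _ q) (*-comm _ _))) p ⟩
    ⟪ (λ d → eval x q * monomial x d) ⟫ p
      ≈⟨ ⟪⟫-* _ _ p ⟩
    eval x q * eval x p
      ≈⟨ *-comm _ _ ⟩
    eval x p * eval x q ∎

  eval-z : ∀ x j → eval x (z j) ≈ x j
  eval-z x j = trans (+-identityʳ _) (trans (*-identityˡ _) (monomial-1 x j))

-- Coefficient families of lists of pairs

module Combinations {c ℓ} (R : CommutativeRing c ℓ) where

  open CommutativeRing R hiding (zero)
  open import Algebra.Properties.CommutativeSemigroup +-commutativeSemigroup
    using () renaming (interchange to +-interchange)
  open import Algebra.Properties.Semiring.Sum semiring using (sum)

  private
    variable
      a b k k′ : Level
      A : Set a
      B : Set b
      K : Set k
      K′ : Set k′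

  combination : (L : List A) → (Fin (length L) → Carrier) → (A → Carrier) → Carrier
  combination []      a φ = 0#
  combination (x ∷ L) a φ = a zero * φ x + combination L (a ∘ suc) φ

  -- K parametrises the coefficient families of L; ev k is the combination
  -- with coefficients k, and Zero k says that all these coefficients vanish.
  record Parametrisation {A : Set a} (L : List A) (K : Set k)
      (ev : K → (A → Carrier) → Carrier) (Zero : K → Set ℓ) : Set (a ⊔ k ⊔ c ⊔ ℓ) where
    field
      to        : (Fin (length L) → Carrier) → K
      from      : K → Fin (length L) → Carrier
      to-ev     : ∀ u φ → ev (to u) φ ≈ combination L u φ
      from-ev   : ∀ x φ → combination L (from x) φ ≈ ev x φ
      to-zero   : ∀ u → Zero (to u) → ∀ i → u i ≈ 0#
      from-zero : ∀ x → (∀ i → from x i ≈ 0#) → Zero x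

  open Parametrisation

  parametrise-[] : Parametrisation {A = A} [] (⊤ {c}) (λ _ _ → 0#) (λ _ → ⊤)
  parametrise-[] = record
    { to = _ ; from = λ _ () ; to-ev = λ _ _ → refl ; from-ev = λ _ _ → refl
    ; to-zero = λ _ _ () ; from-zero = _ }

  module _ {L : List A} {ev : K → (A → Carrier) → Carrier} {Zero : K → Set ℓ} where

    parametrise-∷ : ∀ x → Parametrisation L K ev Zero →
      Parametrisation (x ∷ L) (Carrier × K)
        (λ (a , k) φ → a * φ x + ev k φ) (λ (a , k) → a ≈ 0# × Zero k)
    parametrise-∷ x P = record
      { to        = λ u → u zero , to P (u ∘ suc)
      ; from      = λ { (a , k) zero → a ; (a , k) (suc i) → from P k i }
      ; to-ev     = λ u φ → +-congˡ (to-ev P (u ∘ suc) φ)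
      ; from-ev   = λ (a , k) φ → +-congˡ (from-ev P k φ)
      ; to-zero   = λ { u (p , q) zero → p ; u (p , q) (suc i) → to-zero P (u ∘ suc) q i }
      ; from-zero = λ (a , k) h → h zero , from-zero P k (h ∘ suc)
      }

    -- The maps `f` and `g` need not be inverse to each other. Compatibility with evaluation and
    -- with vanishing is enough to pass, for instance, between triangular arrays and square
    -- matrices.
    reparametrise : {ev′ : K′ → (A → Carrier) → Carrier} {Zero′ : K′ → Set ℓ} →
      (f : K → K′) (g : K′ → K) →
      (∀ x φ → ev′ (f x) φ ≈ ev x φ) → (∀ y φ → ev (g y) φ ≈ ev′ y φ) →
      (∀ x → Zero′ (f x) → Zero x) → (∀ y → Zero (g y) → Zero′ y) →
      Parametrisation L K ev Zero → Parametrisation L K′ ev′ Zero′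
    reparametrise f g f-ev g-ev f-zero g-zero P = record
      { to        = f ∘ to P
      ; from      = from P ∘ g
      ; to-ev     = λ u φ → trans (f-ev (to P u) φ) (to-ev P u φ)
      ; from-ev   = λ y φ → trans (from-ev P (g y) φ) (g-ev y φ)
      ; to-zero   = λ u → to-zero P u ∘ f-zero (to P u)
      ; from-zero = λ y → g-zero y ∘ from-zero P (g y)
      }

  module _ {A : Set a} where

    -- The index maps recurse on `L`, which avoids casts along an equation for `length (L ++ M)`.
    left : ∀ (L {M} : List A) → Fin (length L) → Fin (length (L ++ M))
    left (x ∷ L) zero    = zero
    left (x ∷ L) (suc i) = suc (left L i)

    right : ∀ (L {M} : List A) → Fin (length M) → Fin (length (L ++ M))
    right []      i = i
    right (x ∷ L) i = suc (right L i)

    join : ∀ (L {M} : List A) → (Fin (length L) → B) → (Fin (length M) → B) →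
           Fin (length (L ++ M)) → B
    join []      u v i       = v i
    join (x ∷ L) u v zero    = u zero
    join (x ∷ L) u v (suc i) = join L (u ∘ suc) v i

    combination-++ : ∀ (L {M} : List A) u φ →
      combination L (u ∘ left L) φ + combination M (u ∘ right L) φ ≈ combination (L ++ M) u φ
    combination-++ []      u φ = +-identityˡ _
    combination-++ (x ∷ L) u φ = trans (+-assoc _ _ _) (+-congˡ (combination-++ L (u ∘ suc) φ))

    combination-join : ∀ (L {M} : List A) u v φ →
      combination (L ++ M) (join L u v) φ ≈ combination L u φ + combination M v φ
    combination-join []      u v φ = sym (+-identityˡ _)
    combination-join (x ∷ L) u v φ =
      trans (+-congˡ (combination-join L (u ∘ suc) v φ)) (sym (+-assoc _ _ _))

    left-right : ∀ (L {M} : List A) (P : Fin (length (L ++ M)) → Set ℓ) →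
      (∀ i → P (left L i)) → (∀ i → P (right L i)) → ∀ i → P i
    left-right []      P p q i       = q i
    left-right (x ∷ L) P p q zero    = p zero
    left-right (x ∷ L) P p q (suc i) = left-right L (P ∘ suc) (p ∘ suc) q i

    join-left : ∀ (L {M} : List A) {u : Fin (length L) → B} {v} i →
      join L {M} u v (left L i) ≡ u i
    join-left (x ∷ L) zero    = ≡.refl
    join-left (x ∷ L) (suc i) = join-left L i

    join-right : ∀ (L {M} : List A) {u : Fin (length L) → B} {v} i →
      join L {M} u v (right L i) ≡ v i
    join-right []      i = ≡.refl
    join-right (x ∷ L) i = join-right L i

    parametrise-++ : {L M : List A}
      {ev : K → (A → Carrier) → Carrier} {Zero : K → Set ℓ}
      {ev′ : K′ → (A → Carrier) → Carrier} {Zero′ : K′ → Set ℓ} →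
      Parametrisation L K ev Zero → Parametrisation M K′ ev′ Zero′ →
      Parametrisation (L ++ M) (K × K′)
        (λ (x , y) φ → ev x φ + ev′ y φ) (λ (x , y) → Zero x × Zero′ y)
    parametrise-++ {L = L} {M} P Q = record
      { to        = λ u → to P (u ∘ left L) , to Q (u ∘ right L)
      ; from      = λ (x , y) → join L (from P x) (from Q y)
      ; to-ev     = λ u φ → trans (+-cong (to-ev P _ φ) (to-ev Q _ φ)) (combination-++ L u φ)
      ; from-ev   = λ (x , y) φ →
          trans (combination-join L _ _ φ) (+-cong (from-ev P x φ) (from-ev Q y φ))
      ; to-zero   = λ u (p , q) →
          left-right L (λ i → u i ≈ 0#) (to-zero P (u ∘ left L) p) (to-zero Q (u ∘ right L) q)
      ; from-zero = λ (x , y) h →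
          from-zero P x (λ i → trans (reflexive (≡.sym (join-left L i))) (h (left L i))) ,
          from-zero Q y (λ i → trans (reflexive (≡.sym (join-right L i))) (h (right L i)))
      }

  module _ {A : Set a} {B : Set b} (f : A → B) where

    up : ∀ L → Fin (length L) → Fin (length (map f L))
    up (x ∷ L) zero    = zero
    up (x ∷ L) (suc i) = suc (up L i)

    down : ∀ L → Fin (length (map f L)) → Fin (length L)
    down (x ∷ L) zero    = zero
    down (x ∷ L) (suc i) = suc (down L i)

    down-up : ∀ L i → down L (up L i) ≡ i
    down-up (x ∷ L) zero    = ≡.refl
    down-up (x ∷ L) (suc i) = ≡.cong suc (down-up L i)

    up-down : ∀ L i → up L (down L i) ≡ i
    up-down (x ∷ L) zero    = ≡.refl
    up-down (x ∷ L) (suc i) = ≡.cong suc (up-down L i)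

    combination-up : ∀ L u φ → combination L (u ∘ up L) (φ ∘ f) ≈ combination (map f L) u φ
    combination-up []      u φ = refl
    combination-up (x ∷ L) u φ = +-congˡ (combination-up L (u ∘ suc) φ)

    combination-down : ∀ L u φ → combination (map f L) (u ∘ down L) φ ≈ combination L u (φ ∘ f)
    combination-down []      u φ = refl
    combination-down (x ∷ L) u φ = +-congˡ (combination-down L (u ∘ suc) φ)

    parametrise-map : {L : List A} {ev : K → (A → Carrier) → Carrier} {Zero : K → Set ℓ} →
      Parametrisation L K ev Zero → Parametrisation (map f L) K (λ x φ → ev x (φ ∘ f)) Zero
    parametrise-map {L = L} P = record
      { to        = λ u → to P (u ∘ up L)
      ; from      = λ x → from P x ∘ down L
      ; to-ev     = λ u φ → trans (to-ev P _ _) (combination-up L u φ)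
      ; from-ev   = λ x φ → trans (combination-down L _ φ) (from-ev P x _)
      ; to-zero   = λ u p i → trans (reflexive (≡.cong u (≡.sym (up-down L i))))
          (to-zero P (u ∘ up L) p (down L i))
      ; from-zero = λ x h → from-zero P x λ i →
          trans (reflexive (≡.cong (from P x) (≡.sym (down-up L i)))) (h (up L i))
      }

  parametrise-tabulate : ∀ {A : Set a} {n} (p : Fin n → A) →
    Parametrisation (tabulate p) (Fin n → Carrier)
      (λ u φ → sum (λ i → u i * φ (p i))) (λ u → ∀ i → u i ≈ 0#)
  parametrise-tabulate {n = zero}  p = record
    { to = λ _ () ; from = λ _ () ; to-ev = λ _ _ → refl ; from-ev = λ _ _ → refl
    ; to-zero = λ _ _ () ; from-zero = λ _ _ () }
  parametrise-tabulate {n = suc n} p = reparametrise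
    (λ { (a , u) zero → a ; (a , u) (suc i) → u i })
    (λ u → u zero , u ∘ suc)
    (λ _ _ → refl) (λ _ _ → refl)
    (λ _ h → h zero , h ∘ suc)
    (λ { _ (p , q) zero → p ; _ (p , q) (suc i) → q i })
    (parametrise-∷ (p zero) (parametrise-tabulate (p ∘ suc)))

  sum₂ : ∀ {n} → (Fin n → Fin n → Carrier) → Carrier
  sum₂ {zero}  g = 0#
  sum₂ {suc n} g = sum (λ j → g zero (suc j)) + sum₂ (λ i j → g (suc i) (suc j))

  choose-1 : ∀ {A : Set a} (L : List A) → choose 1 L ≡ map (_∷ []) L
  choose-1 []      = ≡.refl
  choose-1 (x ∷ L) = ≡.cong ((x ∷ []) ∷_) (choose-1 L)

  SingleCoefficients : ℕ → Set c
  SingleCoefficients n = (Fin n → Carrier) × Carrier × Carrier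

  SingleZero : ∀ {n} → SingleCoefficients n → Set ℓ
  SingleZero (u , v , w) = (∀ i → u i ≈ 0#) × v ≈ 0# × w ≈ 0#

  -- With members p_i = z_i², f = f₁² and g = f₂², the fields are the coefficients of z_i²z_j² (for
  -- i < j), z_i²f₁², z_i²f₂² and f₁²f₂².
  record PairCoefficients (n : ℕ) : Set c where
    constructor coefficients
    field
      pp : Fin n → Fin n → Carrier
      pf : Fin n → Carrier
      pg : Fin n → Carrier
      fg : Carrier

  record PairZero {n} (x : PairCoefficients n) : Set ℓ where
    constructor pairZero
    open PairCoefficients x
    field
      pp≈0 : ∀ i j → i < j → pp i j ≈ 0#
      pf≈0 : ∀ i → pf i ≈ 0#
      pg≈0 : ∀ i → pg i ≈ 0#
      fg≈0 : fg ≈ 0#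

  module _ {A : Set a} where

    single : ∀ {n} (p : Fin n → A) (f g : A) → SingleCoefficients n → (A → Carrier) → Carrier
    single p f g (u , v , w) φ = sum (λ i → u i * φ (p i)) + (v * φ f + w * φ g)

    parametrise-single : ∀ {n} (p : Fin n → A) f g →
      Parametrisation (tabulate p ++ f ∷ g ∷ []) (SingleCoefficients n) (single p f g) SingleZero
    parametrise-single p f g = reparametrise
      (λ (u , v , w , _) → u , v , w) (λ (u , v , w) → u , v , w , tt)
      (λ _ _ → +-congˡ (+-congˡ (sym (+-identityʳ _))))
      (λ _ _ → +-congˡ (+-congˡ (+-identityʳ _)))
      (λ _ (x , y , z) → x , y , z , tt)
      (λ _ (x , y , z , _) → x , y , z)
      (parametrise-++ (parametrise-tabulate p) (parametrise-∷ f (parametrise-∷ g parametrise-[])))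

    pair : ∀ {n} (p : Fin n → A) (f g : A) → PairCoefficients n → (List A → Carrier) → Carrier
    pair p f g (coefficients s u v w) φ =
      sum₂ (λ i j → s i j * φ (p i ∷ p j ∷ [])) +
      (sum (λ i → u i * φ (p i ∷ f ∷ [])) + sum (λ i → v i * φ (p i ∷ g ∷ []))) +
      w * φ (f ∷ g ∷ [])

    -- The list `choose 2 (x ∷ L)` starts with the pairs containing `x`, one for each member of `L`,
    -- and continues with `choose 2 L`.
    parametrise-choose-2-∷ : ∀ x {L : List A}
      {ev : K → (A → Carrier) → Carrier} {Zero : K → Set ℓ}
      {ev′ : K′ → (List A → Carrier) → Carrier} {Zero′ : K′ → Set ℓ} →
      Parametrisation L K ev Zero → Parametrisation (choose 2 L) K′ ev′ Zero′ →
      Parametrisation (choose 2 (x ∷ L)) (K × K′)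
        (λ (y , z) φ → ev y (λ t → φ (x ∷ t ∷ [])) + ev′ z φ)
        (λ (y , z) → Zero y × Zero′ z)
    parametrise-choose-2-∷ x {L} P Q rewrite choose-1 L =
      parametrise-++ (parametrise-map (x ∷_) (parametrise-map (_∷ []) P)) Q

    module Step {n : ℕ} where
      extend : SingleCoefficients n × PairCoefficients n → PairCoefficients (suc n)
      extend ((s₀ , u₀ , v₀) , coefficients s u v w) = coefficients s′
        (λ { zero → u₀ ; (suc i) → u i }) (λ { zero → v₀ ; (suc i) → v i }) w
        where
        s′ : Fin (suc n) → Fin (suc n) → Carrier
        -- A default value: no pair i < j has j = 0.
        s′ i       zero    = 0#
        s′ zero    (suc j) = s₀ j
        s′ (suc i) (suc j) = s i j

      restrict : PairCoefficients (suc n) → SingleCoefficients n × PairCoefficients n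
      restrict (coefficients s u v w) =
        ((λ j → s zero (suc j)) , u zero , v zero) ,
        coefficients (λ i j → s (suc i) (suc j)) (u ∘ suc) (v ∘ suc) w

    parametrise-pair : ∀ {n} (p : Fin n → A) f g →
      Parametrisation (choose 2 (tabulate p ++ f ∷ g ∷ []))
        (PairCoefficients n) (pair p f g) PairZero
    parametrise-pair {zero} p f g = reparametrise
      (λ (w , _) → coefficients (λ ()) (λ ()) (λ ()) w) (λ x → PairCoefficients.fg x , tt)
      (λ _ _ → simplify) (λ _ _ → sym simplify)
      (λ _ h → PairZero.fg≈0 h , tt)
      (λ _ (h , _) → pairZero (λ ()) (λ ()) (λ ()) h)
      (parametrise-∷ (f ∷ g ∷ []) parametrise-[])
      where
      simplify : ∀ {x} → 0# + (0# + 0#) + x ≈ x + 0#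
      simplify = trans (+-congʳ (trans (+-identityˡ _) (+-identityˡ _))) (+-comm _ _)
    parametrise-pair {suc n} p f g = reparametrise
      (Step.extend) (Step.restrict)
      (λ _ _ → regroup)
      (λ _ _ → sym regroup)
      (λ _ (pairZero h₁ h₂ h₃ h₄) →
        ((λ i → h₁ zero (suc i) z<s) , h₂ zero , h₃ zero) ,
        pairZero (λ i j i<j → h₁ (suc i) (suc j) (s<s i<j)) (h₂ ∘ suc) (h₃ ∘ suc) h₄)
      (λ { _ ((h₁ , h₂ , h₃) , pairZero k₁ k₂ k₃ k₄) → pairZero
        (λ { zero (suc j) _ → h₁ j ; (suc i) (suc j) (s<s i<j) → k₁ i j i<j })
        (λ { zero → h₂ ; (suc i) → k₂ i })
        (λ { zero → h₃ ; (suc i) → k₃ i })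
        k₄ })
      (parametrise-choose-2-∷ (p zero) (parametrise-single (p ∘ suc) f g)
        (parametrise-pair (p ∘ suc) f g))
      where
      regroup : ∀ {x x′ y y′ z z′ w} →
        (x + x′) + ((y + y′) + (z + z′)) + w ≈ (x + (y + z)) + ((x′ + (y′ + z′)) + w)
      regroup = trans (+-congʳ (trans (+-congˡ (+-interchange _ _ _ _)) (+-interchange _ _ _ _)))
        (+-assoc _ _ _)

-- Kronecker sums and polarisation

module KroneckerSums {c ℓ} (R : CommutativeRing c ℓ) where
  open CommutativeRing R hiding (zero)
  open import Algebra.Properties.Semiring.Sum semiring
    using (sum; sum-cong-≋; sum-replicate-zero)
  open import Relation.Binary.Reasoning.Setoid setoid
  open Combinations R using (sum₂)

  sum-cong : ∀ {n} {f g : Fin n → Carrier} → (∀ i → f i ≈ g i) → sum f ≈ sum g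
  sum-cong = sum-cong-≋

  sum-zero : ∀ {n} {f : Fin n → Carrier} → (∀ i → f i ≈ 0#) → sum f ≈ 0#
  sum-zero {n} f≈0 = trans (sum-cong f≈0) (sum-replicate-zero n)

  sum-pick : ∀ {n} i {f : Fin n → Carrier} → (∀ p → p ≢ i → f p ≈ 0#) → sum f ≈ f i
  sum-pick zero    f≈0 = trans (+-congˡ (sum-zero (λ p → f≈0 (suc p) λ ()))) (+-identityʳ _)
  sum-pick (suc i) f≈0 = trans (+-cong (f≈0 zero λ ())
    (sum-pick i (λ p p≢i → f≈0 (suc p) (p≢i ∘ Fin.suc-injective)))) (+-identityˡ _)

  sum₂-cong : ∀ {n} {f g : Fin n → Fin n → Carrier} → (∀ i j → f i j ≈ g i j) → sum₂ f ≈ sum₂ g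
  sum₂-cong {zero}  f≈g = refl
  sum₂-cong {suc n} f≈g =
    +-cong (sum-cong (λ j → f≈g zero (suc j))) (sum₂-cong (λ i j → f≈g (suc i) (suc j)))

  sum₂-zero : ∀ {n} {g : Fin n → Fin n → Carrier} →
    (∀ p q → p < q → g p q ≈ 0#) → sum₂ g ≈ 0#
  sum₂-zero {zero}  g≈0 = refl
  sum₂-zero {suc n} g≈0 = trans
    (+-cong (sum-zero (λ j → g≈0 zero (suc j) (ℕ.s≤s ℕ.z≤n)))
            (sum₂-zero (λ p q p<q → g≈0 (suc p) (suc q) (s<s p<q))))
    (+-identityʳ 0#)

  sum₂-pick : ∀ {n} i j {g : Fin n → Fin n → Carrier} → i < j →
    (∀ p q → p < q → ¬ (p ≡ i × q ≡ j) → g p q ≈ 0#) → sum₂ g ≈ g i j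
  sum₂-pick zero (suc j) _ g≈0 = trans
    (+-cong (sum-pick j (λ p p≢j → g≈0 zero (suc p) (ℕ.s≤s ℕ.z≤n)
              (p≢j ∘ Fin.suc-injective ∘ proj₂)))
            (sum₂-zero (λ p q p<q → g≈0 (suc p) (suc q) (s<s p<q) λ ())))
    (+-identityʳ _)
  sum₂-pick (suc i) (suc j) (s<s i<j) g≈0 = trans
    (+-cong (sum-zero (λ p → g≈0 zero (suc p) (ℕ.s≤s ℕ.z≤n) λ ()))
            (sum₂-pick i j i<j (λ p q p<q pq≢ij → g≈0 (suc p) (suc q) (s<s p<q)
              λ (p≡i , q≡j) → pq≢ij (Fin.suc-injective p≡i , Fin.suc-injective q≡j))))
    (+-identityˡ _)

  δ : ∀ {n} → Fin n → Fin n → Carrier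
  δ zero    zero    = 1#
  δ zero    (suc j) = 0#
  δ (suc i) zero    = 0#
  δ (suc i) (suc j) = δ i j

  δ-refl : ∀ {n} (i : Fin n) → δ i i ≡ 1#
  δ-refl zero    = ≡.refl
  δ-refl (suc i) = δ-refl i

  δ-≢ : ∀ {n} {i j : Fin n} → i ≢ j → δ i j ≡ 0#
  δ-≢ {i = zero}  {zero}  i≢j = contradiction ≡.refl i≢j
  δ-≢ {i = zero}  {suc j} i≢j = ≡.refl
  δ-≢ {i = suc i} {zero}  i≢j = ≡.refl
  δ-≢ {i = suc i} {suc j} i≢j = δ-≢ (i≢j ∘ ≡.cong suc)

  sum-δ : ∀ {n} (i : Fin n) (x : Fin n → Carrier) → sum (λ j → δ i j * x j) ≈ x i
  sum-δ i x = trans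
    (sum-pick i (λ p p≢i → trans (*-congʳ (reflexive (δ-≢ (p≢i ∘ ≡.sym)))) (zeroˡ _)))
    (trans (*-congʳ (reflexive (δ-refl i))) (*-identityˡ _))

  δδ≈0 : ∀ {n} (p : Fin n) {x y} → x ≢ y → δ p x * δ p y ≈ 0#
  δδ≈0 p {x} {y} x≢y with p Fin.≟ x
  ... | yes ≡.refl = trans (*-congˡ (reflexive (δ-≢ x≢y))) (zeroʳ _)
  ... | no p≢x     = trans (*-congʳ (reflexive (δ-≢ p≢x))) (zeroˡ _)

  -- When z_k² Σ x_q z_q² is expanded, the pair p < q receives `δ k p * x q + δ k q * x p`, and the
  -- square of z_k² receives `x k`. This serves to multiply a relation by z_k².
  sum₂-δ : ∀ {n} (k : Fin n) (x : Fin n → Carrier) (g : Fin n → Fin n → Carrier) → (∀ p q → g p q ≈ g q p) →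
    sum₂ (λ p q → (δ k p * x q + δ k q * x p) * g p q) + x k * g k k ≈ sum (λ q → x q * g q k)
  sum₂-δ {suc n} zero x g g-sym = begin
    sum (λ q → (1# * x (suc q) + 0# * x zero) * g zero (suc q)) +
      sum₂ (λ p q → (0# * x (suc q) + 0# * x (suc p)) * g (suc p) (suc q)) + x zero * g zero zero
      ≈⟨ +-congʳ (+-cong
           (sum-cong {n} (λ q → *-cong (trans (+-cong (*-identityˡ _) (zeroˡ _)) (+-identityʳ _)) (g-sym _ _)))
           (sum₂-zero {n} (λ p q _ → trans (*-congʳ (trans (+-cong (zeroˡ _) (zeroˡ _)) (+-identityʳ _))) (zeroˡ _)))) ⟩
    sum (λ q → x (suc q) * g (suc q) zero) + 0# + x zero * g zero zero
      ≈⟨ trans (+-congʳ (+-identityʳ _)) (+-comm _ _) ⟩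
    x zero * g zero zero + sum (λ q → x (suc q) * g (suc q) zero) ∎
  sum₂-δ {suc n} (suc k) x g g-sym = begin
    sum (λ q → (0# * x (suc q) + δ k q * x zero) * g zero (suc q)) + rest + x (suc k) * g (suc k) (suc k)
      ≈⟨ +-assoc _ _ _ ⟩
    sum (λ q → (0# * x (suc q) + δ k q * x zero) * g zero (suc q)) + (rest + x (suc k) * g (suc k) (suc k))
      ≈⟨ +-cong
           (trans (sum-cong {n} (λ q → trans (*-congʳ (trans (+-congʳ (zeroˡ _)) (+-identityˡ _))) (*-assoc _ _ _)))
             (sum-δ {n} k (λ q → x zero * g zero (suc q))))
           (sum₂-δ k (x ∘ suc) (λ p q → g (suc p) (suc q)) (λ p q → g-sym _ _)) ⟩
    x zero * g zero (suc k) + sum (λ q → x (suc q) * g (suc q) (suc k)) ∎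
    where
    rest = sum₂ (λ p q → (δ k p * x (suc q) + δ k q * x (suc p)) * g (suc p) (suc q))

module Polarisation {c ℓ} (R : CommutativeRing c ℓ) where
  open CommutativeRing R hiding (zero)
  open import Algebra.Solver.Ring.NaturalCoefficients.Default commutativeSemiring

  -- Written as a double doubling, so that cancelling 2 twice removes it.
  4*_ : Carrier → Carrier
  4* x = (1# + 1#) * ((1# + 1#) * x)

  total : ∀ {x} {X : Set x} → (X → Carrier) → List X → Carrier
  total f = foldr (λ x s → f x + s) 0#

  -- The sum runs over the six ways to give two of the four positions to `h` and the other two to
  -- `k`. For linear forms with coefficients `h` and `k`, four times `Q` is the full polarisation of
  -- the quartic h²k².
  Q : ∀ {x} {X : Set x} → (h k : X → Carrier) → X → X → X → X → Carrier
  Q h k s t u v =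
    h s * h t * (k u * k v) + h s * h u * (k t * k v) + h s * h v * (k t * k u) +
    h t * h u * (k s * k v) + h t * h v * (k s * k u) + h u * h v * (k s * k t)

  evens odds : ∀ {x} {X : Set x} → X → X → X → X → List (List X)
  evens s t u v =
    (s ∷ t ∷ u ∷ v ∷ []) ∷ (s ∷ t ∷ []) ∷ (s ∷ u ∷ []) ∷ (s ∷ v ∷ []) ∷
    (t ∷ u ∷ []) ∷ (t ∷ v ∷ []) ∷ (u ∷ v ∷ []) ∷ []
  odds s t u v =
    (s ∷ t ∷ u ∷ []) ∷ (s ∷ t ∷ v ∷ []) ∷ (s ∷ u ∷ v ∷ []) ∷ (t ∷ u ∷ v ∷ []) ∷
    (s ∷ []) ∷ (t ∷ []) ∷ (u ∷ []) ∷ (v ∷ []) ∷ []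

  -- The alternating sum over the nonempty subsets of the four arguments, with the
  -- subsets of odd size moved to the right.
  polarise : ∀ {x} {X : Set x} (h k : X → Carrier) s t u v →
    let N S = (total h S * total h S) * (total k S * total k S) in
    total N (evens s t u v) ≈ total N (odds s t u v) + 4* Q h k s t u v
  polarise h k s t u v =
    solve 8 (λ a b c d p q r s →
      let sum′ : ∀ {x} {X : Set x} → (X → Polynomial 8) → List X → Polynomial 8
          sum′ f = foldr (λ x s → f x :+ s) (con 0)
          N : List (Polynomial 8 × Polynomial 8) → Polynomial 8
          N S = (sum′ proj₁ S :* sum′ proj₁ S) :* (sum′ proj₂ S :* sum′ proj₂ S)
          evens′ = evens (a , p) (b , q) (c , r) (d , s)
          odds′ = odds (a , p) (b , q) (c , r) (d , s)
      in sum′ N evens′ := sum′ N odds′ :+ (con 1 :+ con 1) :* ((con 1 :+ con 1) :*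
        (a :* b :* (r :* s) :+ a :* c :* (q :* s) :+ a :* d :* (q :* r) :+
         b :* c :* (p :* s) :+ b :* d :* (p :* r) :+ c :* d :* (p :* q))))
      refl (h s) (h t) (h u) (h v) (k s) (k t) (k u) (k v)

  polarise-square : ∀ {x} {X : Set x} (h : X → Carrier) s t →
    let N S = total h S * total h S in
    total N ((s ∷ t ∷ []) ∷ []) ≈
    total N ((s ∷ []) ∷ (t ∷ []) ∷ []) + (1# + 1#) * (h s * h t)
  polarise-square h s t = solve 2 (λ a b →
    (a :+ (b :+ con 0)) :* (a :+ (b :+ con 0)) :+ con 0 :=
    ((a :+ con 0) :* (a :+ con 0) :+ ((b :+ con 0) :* (b :+ con 0) :+ con 0))
      :+ (con 1 :+ con 1) :* (a :* b)) refl (h s) (h t)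

-- Linear independence and polarisation for the family S₁

module Families {c ℓ} (R : CommutativeRing c ℓ) (r : ℕ) where
  open CommutativeRing R hiding (zero)
  open Polynomials R r
  open Functionals R r
  open Combinations R
  open KroneckerSums R
  open Polarisation R
  open import Algebra.Properties.Ring ring using (-1*x≈-x)
  open import Algebra.Properties.Semiring.Sum semiring
    using (sum; ∑-distrib-+)
  open import Relation.Binary.Reasoning.Setoid setoid

  linear : (Fin r → Carrier) → Poly
  linear a = sumₚ (λ j → a j ·ₚ z j)

  z² : Fin r → Poly
  z² j = z j *ₚ z j

  _² : (Fin r → Carrier) → Poly
  a ² = linear a *ₚ linear a

  family : (a b : Fin r → Carrier) → List Poly
  family a b = tabulate z² ++ a ² ∷ b ² ∷ []

  ⟪⟫-combination : ∀ φ L u →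
    ⟪ φ ⟫ (sumₚ (λ i → u i ·ₚ lookup L i)) ≈ combination L u ⟪ φ ⟫
  ⟪⟫-combination φ []      u = refl
  ⟪⟫-combination φ (p ∷ L) u =
    trans (⟪⟫-++ φ (u zero ·ₚ p) (sumₚ (λ i → u (suc i) ·ₚ lookup L i))) (+-cong (⟪⟫-· φ (u zero) p) (⟪⟫-combination φ L (u ∘ suc)))

  module _ {k} {K : Set k} {L : List Poly} {ev : K → (Poly → Carrier) → Carrier} {Zero : K → Set ℓ}
      (P : Parametrisation L K ev Zero) where
    open Parametrisation P

    -- Taking a coefficient is one of the functionals, so a combination killed by all functionals is
    -- the zero polynomial. The converse direction `independent⇐` rests on `⟪⟫-vanishing`.
    independent⇒ : LinearlyIndependent L → ∀ x → (∀ φ → ev x ⟪ φ ⟫ ≈ 0#) → Zero x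
    independent⇒ li x ev≈0 = from-zero x (li (from x) λ e → begin
      coeff (sumₚ (λ i → from x i ·ₚ lookup L i)) e
        ≈⟨ coeff≈ (sumₚ (λ i → from x i ·ₚ lookup L i)) e ⟩
      ⟪ indicator e ⟫ (sumₚ (λ i → from x i ·ₚ lookup L i))
        ≈⟨ ⟪⟫-combination _ L (from x) ⟩
      combination L (from x) ⟪ indicator e ⟫
        ≈⟨ from-ev x _ ⟩
      ev x ⟪ indicator e ⟫
        ≈⟨ ev≈0 _ ⟩
      0# ∎)

    independent⇐ : (∀ x → (∀ φ → ev x ⟪ φ ⟫ ≈ 0#) → Zero x) → LinearlyIndependent L
    independent⇐ h u relation = to-zero u (h (to u) λ φ → begin
      ev (to u) ⟪ φ ⟫
        ≈⟨ to-ev u _ ⟩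
      combination L u ⟪ φ ⟫
        ≈⟨ ⟪⟫-combination φ L u ⟨
      ⟪ φ ⟫ (sumₚ (λ i → u i ·ₚ lookup L i))
        ≈⟨ ⟪⟫-vanishing φ (sumₚ (λ i → u i ·ₚ lookup L i)) relation ⟩
      0# ∎)

  ⟪⟫-*ₚ-comm : ∀ φ p q → ⟪ φ ⟫ (p *ₚ q) ≈ ⟪ φ ⟫ (q *ₚ p)
  ⟪⟫-*ₚ-comm φ p q = begin
    ⟪ φ ⟫ (p *ₚ q)                          ≈⟨ ⟪⟫-*ₚ φ p q ⟩
    ⟪ (λ d → ⟪ (λ e → φ (d ⊕ e)) ⟫ q) ⟫ p   ≈⟨ ⟪⟫-swap _ p q ⟩
    ⟪ (λ e → ⟪ (λ d → φ (d ⊕ e)) ⟫ p) ⟫ q   ≈⟨ ⟪⟫-cong (λ e → ⟪⟫-cong (λ d →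
                                                 reflexive-at φ (⊕-comm d e)) p) q ⟩
    ⟪ (λ e → ⟪ (λ d → φ (e ⊕ d)) ⟫ p) ⟫ q   ≈⟨ ⟪⟫-*ₚ φ q p ⟨
    ⟪ φ ⟫ (q *ₚ p)                          ∎

  ⟪⟫-linear : ∀ φ a → ⟪ φ ⟫ (linear a) ≈ sum (λ j → a j * ⟪ φ ⟫ (z j))
  ⟪⟫-linear φ a = trans (⟪⟫-sumₚ φ (λ j → a j ·ₚ z j)) (sum-cong (λ j → ⟪⟫-· φ (a j) (z j)))

  ⟪⟫-linear-* : ∀ φ a q → ⟪ φ ⟫ (linear a *ₚ q) ≈ sum (λ j → a j * ⟪ φ ⟫ (z j *ₚ q))
  ⟪⟫-linear-* φ a q = trans (⟪⟫-*ₚ φ (linear a) q)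
    (trans (⟪⟫-linear _ a) (sum-cong (λ j → *-congˡ (sym (⟪⟫-*ₚ φ (z j) q)))))

  ⟪⟫-² : ∀ φ a → ⟪ φ ⟫ (a ²) ≈ sum (λ i → a i * sum (λ j → a j * ⟪ φ ⟫ (z j *ₚ z i)))
  ⟪⟫-² φ a = trans (⟪⟫-linear-* φ a (linear a))
    (sum-cong (λ i → *-congˡ (trans (⟪⟫-*ₚ-comm φ (z i) (linear a)) (⟪⟫-linear-* φ a (z i)))))

  eval-linear : ∀ x a → eval x (linear a) ≈ sum (λ j → a j * x j)
  eval-linear x a = trans (⟪⟫-linear _ a) (sum-cong (λ j → *-congˡ (eval-z x j)))

  -- A common description of the variables z_p and the forms f₁, f₂, so that each polar functional
  -- has to be computed only once.
  record _IsLinear_ (h : Poly) (a : Fin r → Carrier) : Set (c ⊔ ℓ) where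
    constructor isLinear
    field value : ∀ x → eval x h ≈ sum (λ j → a j * x j)

  linear-isLinear : ∀ a → linear a IsLinear a
  linear-isLinear a = isLinear λ x → eval-linear x a

  z-isLinear : ∀ p → z p IsLinear δ p
  z-isLinear p = isLinear λ x → trans (eval-z x p) (sym (sum-δ p x))

  -- The sum of the unit vectors with the listed indices, where repetitions count. A linear form
  -- takes there the sum of the corresponding coefficients.
  point : List (Fin r) → Fin r → Carrier
  point is j = total (λ i → δ i j) is

  value-point : ∀ {h a} → h IsLinear a → ∀ is → eval (point is) h ≈ total a is
  value-point {h} {a} lin is = trans (_IsLinear_.value lin (point is)) (go is)
    where
    go : ∀ is → sum (λ j → a j * point is j) ≈ total a is
    go []       = sum-zero (λ j → zeroʳ (a j))
    go (i ∷ is) = trans (sum-cong (λ j → distribˡ (a j) _ _)) (trans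
      (∑-distrib-+ (λ j → a j * δ i j) (λ j → a j * point is j))
      (+-cong (trans (sum-cong (λ j → *-comm (a j) _)) (sum-δ i a)) (go is)))

  evaluations : List (List (Fin r)) → Vec ℕ r → Carrier
  evaluations Ss d = total (λ S → monomial (point S) d) Ss

  ⟪⟫-evaluations : ∀ Ss p → ⟪ evaluations Ss ⟫ p ≈ total (λ S → eval (point S) p) Ss
  ⟪⟫-evaluations []       p = ⟪⟫-zero (λ _ → refl) p
  ⟪⟫-evaluations (S ∷ Ss) p = trans (⟪⟫-+ _ (evaluations Ss) p) (+-congˡ (⟪⟫-evaluations Ss p))

  -- Subtraction is written as multiplication by `- 1#`, so that linearity in the form `⟪⟫-+` and
  -- `⟪⟫-*` applies.
  difference : (Ss Ts : List (List (Fin r))) → Vec ℕ r → Carrier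
  difference Ss Ts d = evaluations Ss d + - 1# * evaluations Ts d

  total-cong : ∀ {x} {X : Set x} {f g : X → Carrier} → (∀ x → f x ≈ g x) → ∀ xs → total f xs ≈ total g xs
  total-cong f≈g []       = refl
  total-cong f≈g (x ∷ xs) = +-cong (f≈g x) (total-cong f≈g xs)

  ⟪⟫-difference : ∀ Ss Ts p N {y} → (∀ S → eval (point S) p ≈ N S) →
    total N Ss ≈ total N Ts + y → ⟪ difference Ss Ts ⟫ p ≈ y
  ⟪⟫-difference Ss Ts p N {y} p≈N eq = begin
    ⟪ difference Ss Ts ⟫ p
      ≈⟨ ⟪⟫-+ _ _ p ⟩
    ⟪ evaluations Ss ⟫ p + ⟪ (λ d → - 1# * evaluations Ts d) ⟫ p
      ≈⟨ +-cong (trans (⟪⟫-evaluations Ss p) (total-cong p≈N Ss))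
           (trans (⟪⟫-* (- 1#) _ p) (*-congˡ (trans (⟪⟫-evaluations Ts p) (total-cong p≈N Ts)))) ⟩
    total N Ss + - 1# * total N Ts
      ≈⟨ +-cong (trans eq (+-comm _ _)) (-1*x≈-x _) ⟩
    y + total N Ts + - total N Ts
      ≈⟨ trans (+-assoc _ _ _) (trans (+-congˡ (-‿inverseʳ _)) (+-identityʳ y)) ⟩
    y ∎

  polar₂ : Fin r → Fin r → Vec ℕ r → Carrier
  polar₂ i j = difference ((i ∷ j ∷ []) ∷ []) ((i ∷ []) ∷ (j ∷ []) ∷ [])

  -- On quartic forms this is the full polarisation at four unit vectors: the alternating sum of the
  -- values at the sums over nonempty subsets.
  polar₄ : Fin r → Fin r → Fin r → Fin r → Vec ℕ r → Carrier
  polar₄ i j k l = difference (evens i j k l) (odds i j k l)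

  ⟪polar₂⟫ : ∀ {h a} → h IsLinear a → ∀ i j → ⟪ polar₂ i j ⟫ (h *ₚ h) ≈ (1# + 1#) * (a i * a j)
  ⟪polar₂⟫ {h} {a} lin i j = ⟪⟫-difference ((i ∷ j ∷ []) ∷ []) ((i ∷ []) ∷ (j ∷ []) ∷ []) (h *ₚ h) _
    (λ S → trans (eval-* _ h h) (*-cong (value-point lin S) (value-point lin S)))
    (polarise-square a i j)

  ⟪polar₄⟫ : ∀ {h k a b} → h IsLinear a → k IsLinear b → ∀ i j m l →
    ⟪ polar₄ i j m l ⟫₂ (h *ₚ h) (k *ₚ k) ≈ 4* Q a b i j m l
  ⟪polar₄⟫ {h} {k} {a} {b} lin lin′ i j m l =
    ⟪⟫-difference (evens i j m l) (odds i j m l) ((h *ₚ h) *ₚ ((k *ₚ k) *ₚ 1ₚ)) _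
    (λ S → trans (eval-* _ (h *ₚ h) _) (*-cong
      (trans (eval-* _ h h) (*-cong (value-point lin S) (value-point lin S)))
      (trans (⟪⟫-*1 _ (k *ₚ k)) (trans (eval-* _ k k) (*-cong (value-point lin′ S) (value-point lin′ S))))))
    (polarise a b i j m l)

-- The equations between the coefficients

-- Equality with 0 need not be decidable; ¬¬-stability permits case
-- distinctions on it while proving that something vanishes.
record IsStableDomain {c ℓ} (R : CommutativeRing c ℓ) : Set (c ⊔ ℓ) where
  open CommutativeRing R
  field
    stable : ∀ {x} → ¬ ¬ x ≈ 0# → x ≈ 0#
    cancel : ∀ {x y} → x * y ≈ 0# → ¬ x ≈ 0# → y ≈ 0#
    2≉0    : ¬ 1# + 1# ≈ 0#
    3≉0    : ¬ 1# + 1# + 1# ≈ 0#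

module StableDomain {c ℓ} {R : CommutativeRing c ℓ} (dom : IsStableDomain R) where
  open CommutativeRing R hiding (zero)
  open Polarisation R using (4*_)
  open IsStableDomain dom public

  1≉0 : ¬ 1# ≈ 0#
  1≉0 1≈0 = 2≉0 (trans (+-cong 1≈0 1≈0) (+-identityʳ 0#))

  cancelʳ : ∀ {x y} → x * y ≈ 0# → ¬ y ≈ 0# → x ≈ 0#
  cancelʳ xy≈0 = cancel (trans (*-comm _ _) xy≈0)

  x≈0⇒x*y≈0 : ∀ {x y} → x ≈ 0# → x * y ≈ 0#
  x≈0⇒x*y≈0 x≈0 = trans (*-congʳ x≈0) (zeroˡ _)

  y≈0⇒x*y≈0 : ∀ {x y} → y ≈ 0# → x * y ≈ 0#
  y≈0⇒x*y≈0 y≈0 = trans (*-congˡ y≈0) (zeroʳ _)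

  *-≉0 : ∀ {x y} → ¬ x ≈ 0# → ¬ y ≈ 0# → ¬ x * y ≈ 0#
  *-≉0 x≉0 y≉0 xy≈0 = y≉0 (cancel xy≈0 x≉0)

  +-≈0 : ∀ {x y} → x ≈ 0# → y ≈ 0# → x + y ≈ 0#
  +-≈0 x≈0 y≈0 = trans (+-cong x≈0 y≈0) (+-identityʳ 0#)

  cancel-+ : ∀ {x y} → x + y ≈ 0# → y ≈ 0# → x ≈ 0#
  cancel-+ x+y≈0 y≈0 = trans (sym (trans (+-congˡ y≈0) (+-identityʳ _))) x+y≈0

  square-≈0 : ∀ {x} → x * x ≈ 0# → x ≈ 0#
  square-≈0 xx≈0 = stable λ x≉0 → x≉0 (cancel xx≈0 x≉0)

  4*-cancel : ∀ {x} → 4* x ≈ 0# → x ≈ 0#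
  4*-cancel 4x≈0 = cancel (cancel 4x≈0 2≉0) 2≉0

module CoefficientEquations {c ℓ} {R : CommutativeRing c ℓ} (dom : IsStableDomain R) {r : ℕ} where
  open CommutativeRing R hiding (zero)
  open StableDomain dom
  open Polarisation R using (Q)
  open import Algebra.Solver.Ring.NaturalCoefficients.Default commutativeSemiring
  open import Algebra.Properties.Ring ring using (-‿distribˡ-*)
  open import Relation.Binary.Reasoning.Setoid setoid

  -- Only off-diagonal entries are tested because the squares z_i² can absorb any diagonal.
  OffDiagonalIndependent : (a b : Fin r → Carrier) → Set (c ⊔ ℓ)
  OffDiagonalIndependent a b = ∀ x y →
    (∀ i j → i ≢ j → x * (a i * a j) + y * (b i * b j) ≈ 0#) → x ≈ 0# × y ≈ 0#

  -- The subscripts give the multiplicities in the quadruples iiii, iiij, iijk and ijkl, with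
  -- numerical factors already cancelled. The remaining pattern iijj is the only one that sees the
  -- coefficients of the z_p²z_q².
  record Equations (a b u v : Fin r → Carrier) (w : Carrier) : Set ℓ where
    field
      eq₄    : ∀ i →
        u i * (a i * a i) + v i * (b i * b i) + w * (a i * a i * (b i * b i)) ≈ 0#
      eq₃₁   : ∀ i j → i ≢ j →
        u i * (a i * a j) + v i * (b i * b j) +
        w * (a i * a i * (b i * b j) + a i * a j * (b i * b i)) ≈ 0#
      eq₂₁₁  : ∀ i j k → i ≢ j → i ≢ k → j ≢ k →
        u i * (a j * a k) + v i * (b j * b k) +
        w * (a i * a i * (b j * b k) + a j * a k * (b i * b i) +
             (1# + 1#) * (a i * a j * (b i * b k) + a i * a k * (b i * b j))) ≈ 0#
      eq₁₁₁₁ : ∀ i j k l → i ≢ j → i ≢ k → i ≢ l → j ≢ k → j ≢ l → k ≢ l →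
        w * Q a b i j k l ≈ 0#

  module _ {a b u v : Fin r → Carrier} {w : Carrier}
      (H : OffDiagonalIndependent a b) (E : Equations a b u v w) where
    open Equations E

    ¬a-diagonal : ¬ (∀ i j → i ≢ j → a i * a j ≈ 0#)
    ¬a-diagonal h = 1≉0 (proj₁ (H 1# 0# λ i j i≢j →
      +-≈0 (y≈0⇒x*y≈0 (h i j i≢j)) (zeroˡ _)))

    ¬b-diagonal : ¬ (∀ i j → i ≢ j → b i * b j ≈ 0#)
    ¬b-diagonal h = 1≉0 (proj₂ (H 0# 1# λ i j i≢j →
      +-≈0 (zeroˡ _) (y≈0⇒x*y≈0 (h i j i≢j))))

    private
      -- Chosen so that `eq₄` and `eq₃₁` together say that the vector t_i a + s_i b is w p_i² times
      -- the i-th unit vector.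
      p s t : Fin r → Carrier
      p i = a i * b i
      s i = (v i + w * (a i * a i)) * b i
      t i = (u i + w * (b i * b i)) * a i

      ta+sb-diagonal : ∀ i → t i * a i + s i * b i ≈ w * (p i * p i)
      ta+sb-diagonal i = begin
        t i * a i + s i * b i
          ≈⟨ solve 5 (λ a b u v w →
               (u :+ w :* (b :* b)) :* a :* a :+ (v :+ w :* (a :* a)) :* b :* b :=
               (u :* (a :* a) :+ v :* (b :* b) :+ w :* (a :* a :* (b :* b))) :+ w :* (a :* b :* (a :* b)))
               refl (a i) (b i) (u i) (v i) w ⟩
        (u i * (a i * a i) + v i * (b i * b i) + w * (a i * a i * (b i * b i))) + w * (p i * p i)
          ≈⟨ trans (+-congʳ (eq₄ i)) (+-identityˡ _) ⟩
        w * (p i * p i) ∎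

      ta+sb-off-diagonal : ∀ i j → i ≢ j → t i * a j + s i * b j ≈ 0#
      ta+sb-off-diagonal i j i≢j = trans
        (solve 7 (λ a b u v w a′ b′ →
          (u :+ w :* (b :* b)) :* a :* a′ :+ (v :+ w :* (a :* a)) :* b :* b′ :=
          u :* (a :* a′) :+ v :* (b :* b′) :+ w :* (a :* a :* (b :* b′) :+ a :* a′ :* (b :* b)))
          refl (a i) (b i) (u i) (v i) w (a j) (b j))
        (eq₃₁ i j i≢j)

      -- Multiplying `eq₂₁₁` by p_i gives 2 w p_i² (a_j b_k + a_k b_j) plus terms b_i t_i a_j a_k +
      -- a_i s_i b_j b_k. Since the entries j and k of t_i a + s_i b vanish and the entry i is w
      -- p_i², these terms amount to - w p_i² a_j b_k.
      cross : ∀ i j k → i ≢ j → i ≢ k → j ≢ k →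
        w * (p i * p i) * (a j * b k + (1# + 1#) * (a k * b j)) ≈ 0#
      cross i j k i≢j i≢k j≢k = cancel-+ sum≈0
        (+-≈0 (y≈0⇒x*y≈0 (ta+sb-off-diagonal i k i≢k)) (y≈0⇒x*y≈0 (ta+sb-off-diagonal i j i≢j)))
        where
        sum≈0 : w * (p i * p i) * (a j * b k + (1# + 1#) * (a k * b j)) +
          (a j * b i * (t i * a k + s i * b k) + a i * b k * (t i * a j + s i * b j)) ≈ 0#
        sum≈0 = begin
          w * (p i * p i) * (a j * b k + (1# + 1#) * (a k * b j)) +
          (a j * b i * (t i * a k + s i * b k) + a i * b k * (t i * a j + s i * b j))
            ≈⟨ solve 9 (λ a b u v w aj bj ak bk →
                 let p = a :* b
                     s = (v :+ w :* (a :* a)) :* b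
                     t = (u :+ w :* (b :* b)) :* a in
                 w :* (p :* p) :* (aj :* bk :+ (con 1 :+ con 1) :* (ak :* bj)) :+
                 (aj :* b :* (t :* ak :+ s :* bk) :+ a :* bk :* (t :* aj :+ s :* bj)) :=
                 w :* (p :* p) :* (aj :* bk :+ (con 1 :+ con 1) :* (ak :* bj)) :+
                 (aj :* bk :* (t :* a :+ s :* b) :+
                   p :* ((u :+ w :* (b :* b)) :* (aj :* ak) :+ (v :+ w :* (a :* a)) :* (bj :* bk))))
                 refl (a i) (b i) (u i) (v i) w (a j) (b j) (a k) (b k) ⟩
          w * (p i * p i) * (a j * b k + (1# + 1#) * (a k * b j)) +
          (a j * b k * (t i * a i + s i * b i) +
            p i * ((u i + w * (b i * b i)) * (a j * a k) + (v i + w * (a i * a i)) * (b j * b k)))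
            ≈⟨ +-congˡ (+-congʳ (*-congˡ (ta+sb-diagonal i))) ⟩
          w * (p i * p i) * (a j * b k + (1# + 1#) * (a k * b j)) +
          (a j * b k * (w * (p i * p i)) +
            p i * ((u i + w * (b i * b i)) * (a j * a k) + (v i + w * (a i * a i)) * (b j * b k)))
            ≈⟨ solve 9 (λ a b u v w aj bj ak bk →
                 let p = a :* b in
                 w :* (p :* p) :* (aj :* bk :+ (con 1 :+ con 1) :* (ak :* bj)) :+
                 (aj :* bk :* (w :* (p :* p)) :+
                   p :* ((u :+ w :* (b :* b)) :* (aj :* ak) :+ (v :+ w :* (a :* a)) :* (bj :* bk))) :=
                 p :* (u :* (aj :* ak) :+ v :* (bj :* bk) :+
                   w :* (a :* a :* (bj :* bk) :+ aj :* ak :* (b :* b) :+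
                     (con 1 :+ con 1) :* (a :* aj :* (b :* bk) :+ a :* ak :* (b :* bj)))))
                 refl (a i) (b i) (u i) (v i) w (a j) (b j) (a k) (b k) ⟩
          p i * _
            ≈⟨ y≈0⇒x*y≈0 (eq₂₁₁ i j k i≢j i≢k j≢k) ⟩
          0# ∎

      -- Twice `cross` with j and k exchanged, minus `cross` itself, eliminates a_k b_j.
      cross₃ : ∀ i j k → i ≢ j → i ≢ k → j ≢ k →
        (1# + 1# + 1#) * (w * (p i * p i) * (a j * b k)) ≈ 0#
      cross₃ i j k i≢j i≢k j≢k = cancel-+ (trans
        (solve 3 (λ x y z →
           (con 1 :+ con 1 :+ con 1) :* (x :* y) :+ x :* (y :+ (con 1 :+ con 1) :* z) :=
           (con 1 :+ con 1) :* (x :* (z :+ (con 1 :+ con 1) :* y)))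
           refl (w * (p i * p i)) (a j * b k) (a k * b j))
        (y≈0⇒x*y≈0 (cross i k j i≢k i≢j (j≢k ∘ ≡.sym))))
        (cross i j k i≢j i≢k j≢k)

    module _ (w≉0 : ¬ w ≈ 0#) where

      module _ (i : Fin r) (p≉0 : ¬ a i * b i ≈ 0#) where
        private
          bᵢ≉0 : ¬ b i ≈ 0#
          bᵢ≉0 = p≉0 ∘ y≈0⇒x*y≈0

          ab≈0 : ∀ j k → j ≢ i → k ≢ i → j ≢ k → a j * b k ≈ 0#
          ab≈0 j k j≢i k≢i j≢k = cancel
            (cancel (cross₃ i j k (j≢i ∘ ≡.sym) (k≢i ∘ ≡.sym) j≢k) 3≉0)
            (*-≉0 w≉0 (*-≉0 p≉0 p≉0))

        -- If p_i and p_j were both nonzero, then `ab≈0` would confine the supports of `a` and `b`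
        -- to i and j. The off-diagonal parts of aaᵀ and bbᵀ would then have a single entry up to
        -- symmetry and be proportional.
        p-other≈0 : ∀ j → j ≢ i → a j * b j ≈ 0#
        p-other≈0 j j≢i = stable λ pⱼ≉0 →
          let aⱼ≉0 : ¬ a j ≈ 0#
              aⱼ≉0 = pⱼ≉0 ∘ x≈0⇒x*y≈0
              bⱼ≉0 : ¬ b j ≈ 0#
              bⱼ≉0 = pⱼ≉0 ∘ y≈0⇒x*y≈0
              a≈0 : ∀ k → k ≢ i → k ≢ j → a k ≈ 0#
              a≈0 k k≢i k≢j = cancelʳ (ab≈0 k j k≢i j≢i k≢j) bⱼ≉0
              b≈0 : ∀ k → k ≢ i → k ≢ j → b k ≈ 0#
              b≈0 k k≢i k≢j = cancel (ab≈0 j k j≢i k≢i (k≢j ∘ ≡.sym)) aⱼ≉0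
          -- The coefficients b_i b_j and - a_i a_j cancel the one remaining off-diagonal entry, and
          -- the first of them is nonzero.
          in *-≉0 bᵢ≉0 bⱼ≉0 (proj₁ (H (b i * b j) (- (a i * a j)) (dependent a≈0 b≈0)))
          where
          dependent : (∀ k → k ≢ i → k ≢ j → a k ≈ 0#) → (∀ k → k ≢ i → k ≢ j → b k ≈ 0#) →
            ∀ k l → k ≢ l → b i * b j * (a k * a l) + - (a i * a j) * (b k * b l) ≈ 0#
          dependent a≈0 b≈0 k l k≢l with k Fin.≟ i | k Fin.≟ j | l Fin.≟ i | l Fin.≟ j
          ... | no k≢i | no k≢j | _ | _ = +-≈0 (y≈0⇒x*y≈0 (x≈0⇒x*y≈0 (a≈0 k k≢i k≢j)))
                                              (y≈0⇒x*y≈0 (x≈0⇒x*y≈0 (b≈0 k k≢i k≢j)))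
          ... | _ | _ | no l≢i | no l≢j = +-≈0 (y≈0⇒x*y≈0 (y≈0⇒x*y≈0 (a≈0 l l≢i l≢j)))
                                              (y≈0⇒x*y≈0 (y≈0⇒x*y≈0 (b≈0 l l≢i l≢j)))
          ... | yes ≡.refl | _ | yes ≡.refl | _ = contradiction ≡.refl k≢l
          ... | _ | yes ≡.refl | _ | yes ≡.refl = contradiction ≡.refl k≢l
          ... | yes ≡.refl | _ | _ | yes ≡.refl =
            trans (+-congˡ (sym (-‿distribˡ-* _ _))) (trans (+-congʳ (*-comm _ _)) (-‿inverseʳ _))
          ... | _ | yes ≡.refl | yes ≡.refl | _ = trans
            (+-cong (trans (*-comm _ _) (*-cong (*-comm _ _) (*-comm _ _))) (sym (-‿distribˡ-* _ _)))
            (-‿inverseʳ _)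

        private
          vanishing-off-i : (f : Fin r → Carrier) → (∀ j → j ≢ i → f j ≈ 0#) →
            ∀ k l → k ≢ l → f k * f l ≈ 0#
          vanishing-off-i f f≈0 k l k≢l with k Fin.≟ i
          ... | no k≢i     = x≈0⇒x*y≈0 (f≈0 k k≢i)
          ... | yes ≡.refl = y≈0⇒x*y≈0 (f≈0 l (k≢l ∘ ≡.sym))

          -- For j ≠ i, multiplying t_i a_j + s_i b_j = 0 by a_j and using a_j b_j = 0 leaves t_i
          -- a_j² = 0. With t_i nonzero, `a` would vanish off i and aaᵀ would be diagonal. The
          -- argument for `s≈0` multiplies by b_j instead.
          t≈0 : t i ≈ 0#
          t≈0 = stable λ t≉0 → ¬a-diagonal (vanishing-off-i a λ j j≢i →
            square-≈0 (cancel (cancel-+ (trans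
              (solve 4 (λ t s a b → t :* (a :* a) :+ s :* (a :* b) := a :* (t :* a :+ s :* b))
                refl (t i) (s i) (a j) (b j))
              (y≈0⇒x*y≈0 (ta+sb-off-diagonal i j (j≢i ∘ ≡.sym))))
              (y≈0⇒x*y≈0 (p-other≈0 j j≢i))) t≉0))

          s≈0 : s i ≈ 0#
          s≈0 = stable λ s≉0 → ¬b-diagonal (vanishing-off-i b λ j j≢i →
            square-≈0 (cancel (cancel-+ (trans
              (solve 4 (λ t s a b → s :* (b :* b) :+ t :* (a :* b) := b :* (t :* a :+ s :* b))
                refl (t i) (s i) (a j) (b j))
              (y≈0⇒x*y≈0 (ta+sb-off-diagonal i j (j≢i ∘ ≡.sym))))
              (y≈0⇒x*y≈0 (p-other≈0 j j≢i))) s≉0))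

        -- With t_i = s_i = 0 the diagonal entry t_i a_i + s_i b_i vanishes, yet it equals w p_i²,
        -- which is nonzero.
        p≉0⇒⊥ : ⊥
        p≉0⇒⊥ = *-≉0 w≉0 (*-≉0 p≉0 p≉0) (trans (sym (ta+sb-diagonal i))
          (+-≈0 (x≈0⇒x*y≈0 t≈0) (x≈0⇒x*y≈0 s≈0)))

      disjoint-supports : ∀ i → a i * b i ≈ 0#
      disjoint-supports i = stable (p≉0⇒⊥ i)

      -- If a_i a_j is nonzero, disjointness of the supports gives b_i = b_j = 0. Then of the six
      -- terms of `eq₁₁₁₁` at i, j, k, l only a_i a_j b_k b_l survives, so bbᵀ would be diagonal.
      a-diagonal : ∀ i j → i ≢ j → a i * a j ≈ 0#
      a-diagonal i j i≢j = stable λ aa≉0 →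
        ¬b-diagonal (b-diagonal aa≉0
          (cancel (disjoint-supports i) (aa≉0 ∘ x≈0⇒x*y≈0))
          (cancel (disjoint-supports j) (aa≉0 ∘ y≈0⇒x*y≈0)))
        where
        b-diagonal : ¬ a i * a j ≈ 0# → b i ≈ 0# → b j ≈ 0# → ∀ k l → k ≢ l → b k * b l ≈ 0#
        b-diagonal aa≉0 bᵢ≈0 bⱼ≈0 k l k≢l with i Fin.≟ k | i Fin.≟ l | j Fin.≟ k | j Fin.≟ l
        ... | yes ≡.refl | _ | _ | _ = x≈0⇒x*y≈0 bᵢ≈0
        ... | _ | yes ≡.refl | _ | _ = y≈0⇒x*y≈0 bᵢ≈0
        ... | _ | _ | yes ≡.refl | _ = x≈0⇒x*y≈0 bⱼ≈0
        ... | _ | _ | _ | yes ≡.refl = y≈0⇒x*y≈0 bⱼ≈0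
        ... | no i≢k | no i≢l | no j≢k | no j≢l =
          cancel (trans (sym Q≈) (cancel (eq₁₁₁₁ i j k l i≢j i≢k i≢l j≢k j≢l k≢l) w≉0)) aa≉0
          where
          ij : ∀ {x y} → x * (b i * y) ≈ 0#
          ij = y≈0⇒x*y≈0 (x≈0⇒x*y≈0 bᵢ≈0)
          ji : ∀ {x y} → x * (b j * y) ≈ 0#
          ji = y≈0⇒x*y≈0 (x≈0⇒x*y≈0 bⱼ≈0)
          Q≈ : Q a b i j k l ≈ a i * a j * (b k * b l)
          Q≈ = trans (+-cong (+-cong (+-cong (+-cong (+-congˡ ji) ji) ij) ij) ij)
            (trans (+-identityʳ _) (trans (+-identityʳ _) (trans (+-identityʳ _)
              (trans (+-identityʳ _) (+-identityʳ _)))))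

    w≈0 : w ≈ 0#
    w≈0 = stable λ w≉0 → ¬a-diagonal (a-diagonal w≉0)

    -- Once w = 0, `eq₃₁` and `eq₂₁₁` say that u_i aaᵀ + v_i bbᵀ has no off-diagonal entries: the
    -- former where i is one of the two indices, the latter elsewhere.
    u,v≈0 : ∀ i → u i ≈ 0# × v i ≈ 0#
    u,v≈0 i = H (u i) (v i) λ j k j≢k → lemma j k j≢k
      where
      lemma : ∀ j k → j ≢ k → u i * (a j * a k) + v i * (b j * b k) ≈ 0#
      lemma j k j≢k with i Fin.≟ j | i Fin.≟ k
      ... | yes ≡.refl | _          = cancel-+ (eq₃₁ i k j≢k) (x≈0⇒x*y≈0 w≈0)
      ... | no i≢j     | yes ≡.refl = trans
        (+-cong (*-congˡ (*-comm _ _)) (*-congˡ (*-comm _ _)))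
        (cancel-+ (eq₃₁ i j i≢j) (x≈0⇒x*y≈0 w≈0))
      ... | no i≢j     | no i≢k     = cancel-+ (eq₂₁₁ i j k i≢j i≢k j≢k) (x≈0⇒x*y≈0 w≈0)

-- From S₁ to S₂

module Independence {c ℓ} {R : CommutativeRing c ℓ} (dom : IsStableDomain R) (r : ℕ)
    (a b : Fin r → CommutativeRing.Carrier R) where
  open CommutativeRing R hiding (zero)
  open Polynomials R r
  open Functionals R r
  open Combinations R
  open KroneckerSums R
  open Polarisation R
  open Families R r
  open StableDomain dom
  open CoefficientEquations dom
  open import Algebra.Solver.Ring.NaturalCoefficients.Default commutativeSemiring
  open import Algebra.Properties.Semiring.Sum semiring
    using (sum; *-distribˡ-sum; ∑-distrib-+)
  open import Relation.Binary.Reasoning.Setoid setoid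

  Relation₁ : SingleCoefficients r → Set _
  Relation₁ x = ∀ φ → single z² (a ²) (b ²) x ⟪ φ ⟫ ≈ 0#

  Relation₂ : PairCoefficients r → Set _
  Relation₂ x = ∀ φ → pair z² (a ²) (b ²) x (⟪ φ ⟫ ∘ productₚ) ≈ 0#

  Independent₁ Independent₂ : Set _
  Independent₁ = ∀ x → Relation₁ x → SingleZero x
  Independent₂ = ∀ x → Relation₂ x → PairZero x

  private
    parametrise₁ = parametrise-single z² (a ²) (b ²)
    parametrise₂ = parametrise-map productₚ (parametrise-pair z² (a ²) (b ²))

  independent₁⇒ : LinearlyIndependent (family a b) → Independent₁
  independent₁⇒ = independent⇒ parametrise₁

  independent₁⇐ : Independent₁ → LinearlyIndependent (family a b)
  independent₁⇐ = independent⇐ parametrise₁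

  independent₂⇒ : LinearlyIndependent (map productₚ (choose 2 (family a b))) → Independent₂
  independent₂⇒ = independent⇒ parametrise₂

  independent₂⇐ : Independent₂ → LinearlyIndependent (map productₚ (choose 2 (family a b)))
  independent₂⇐ = independent⇐ parametrise₂

  private
    *-sum-sum : ∀ x (f : Fin r → Carrier) (g : Fin r → Fin r → Carrier) →
      x * sum (λ i → f i * sum (λ j → f j * g i j)) ≈ sum (λ i → sum (λ j → x * (f i * f j) * g i j))
    *-sum-sum x f g = trans (*-distribˡ-sum {r} x _) (sum-cong {r} λ i →
      trans (*-congˡ (*-distribˡ-sum {r} (f i) _)) (trans (*-distribˡ-sum {r} x _) (sum-cong {r} λ j →
        trans (*-congˡ (sym (*-assoc _ _ _))) (sym (*-assoc _ _ _)))))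

  -- If x aaᵀ + y bbᵀ is diagonal, then x f₁² + y f₂² is a combination of the z_i², and subtracting
  -- it gives a relation in S₁.
  independent₁⇒off-diagonal : Independent₁ → OffDiagonalIndependent a b
  independent₁⇒off-diagonal li x y off = proj₂ (li (diagonal , x , y) relation)
    where
    m : Fin r → Fin r → Carrier
    m i j = x * (a i * a j) + y * (b i * b j)
    diagonal : Fin r → Carrier
    diagonal i = - m i i
    relation : Relation₁ (diagonal , x , y)
    relation φ = begin
      sum (λ i → - m i i * ζ i i) + (x * ⟪ φ ⟫ (a ²) + y * ⟪ φ ⟫ (b ²))
        ≈⟨ +-congˡ (+-cong
             (trans (*-congˡ (⟪⟫-² φ a)) (*-sum-sum x a ζ))
             (trans (*-congˡ (⟪⟫-² φ b)) (*-sum-sum y b ζ))) ⟩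
      sum (λ i → - m i i * ζ i i) +
        (sum (λ i → sum (λ j → x * (a i * a j) * ζ i j)) + sum (λ i → sum (λ j → y * (b i * b j) * ζ i j)))
        ≈⟨ +-congˡ (∑-distrib-+ {r} _ _) ⟨
      sum (λ i → - m i i * ζ i i) +
        sum (λ i → sum (λ j → x * (a i * a j) * ζ i j) + sum (λ j → y * (b i * b j) * ζ i j))
        ≈⟨ +-congˡ (sum-cong {r} λ i → trans (sym (∑-distrib-+ {r} _ _)) (trans
             (sum-cong {r} (λ j → sym (distribʳ (ζ i j) _ _)))
             (sum-pick i (λ j j≢i → x≈0⇒x*y≈0 (off i j (j≢i ∘ ≡.sym)))))) ⟩
      sum (λ i → - m i i * ζ i i) + sum (λ i → m i i * ζ i i)
        ≈⟨ ∑-distrib-+ {r} _ _ ⟨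
      sum (λ i → - m i i * ζ i i + m i i * ζ i i)
        ≈⟨ sum-zero {r} (λ i → trans (sym (distribʳ (ζ i i) _ _)) (x≈0⇒x*y≈0 (-‿inverseˡ _))) ⟩
      0# ∎
      where
      ζ : Fin r → Fin r → Carrier
      ζ i j = ⟪ φ ⟫ (z j *ₚ z i)

  private
    Q-zeroˡ : ∀ (h k : Fin r → Carrier) {s t u v} →
      h s * h t ≈ 0# → h s * h u ≈ 0# → h s * h v ≈ 0# →
      h t * h u ≈ 0# → h t * h v ≈ 0# → h u * h v ≈ 0# → Q h k s t u v ≈ 0#
    Q-zeroˡ h k p₁ p₂ p₃ p₄ p₅ p₆ = +-≈0 (+-≈0 (+-≈0 (+-≈0 (+-≈0
      (x≈0⇒x*y≈0 p₁) (x≈0⇒x*y≈0 p₂)) (x≈0⇒x*y≈0 p₃)) (x≈0⇒x*y≈0 p₄)) (x≈0⇒x*y≈0 p₅)) (x≈0⇒x*y≈0 p₆)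

    Q-comm : ∀ (h k : Fin r → Carrier) s t u v → Q h k s t u v ≈ Q k h s t u v
    Q-comm h k s t u v = solve 8 (λ a b c d p q r s →
      a :* b :* (r :* s) :+ a :* c :* (q :* s) :+ a :* d :* (q :* r) :+
      b :* c :* (p :* s) :+ b :* d :* (p :* r) :+ c :* d :* (p :* q) :=
      p :* q :* (c :* d) :+ p :* r :* (b :* d) :+ p :* s :* (b :* c) :+
      q :* r :* (a :* d) :+ q :* s :* (a :* c) :+ r :* s :* (a :* b))
      refl (h s) (h t) (h u) (h v) (k s) (k t) (k u) (k v)

    -- Serves to replace the entries of `h = δ i` by 0 and 1 while keeping the six-term shape, which
    -- the solver then simplifies.
    Q-congˡ : ∀ (h k : Fin r → Carrier) {s t u v h₁ h₂ h₃ h₄} →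
      h s ≡ h₁ → h t ≡ h₂ → h u ≡ h₃ → h v ≡ h₄ → Q h k s t u v ≈
      h₁ * h₂ * (k u * k v) + h₁ * h₃ * (k t * k v) + h₁ * h₄ * (k t * k u) +
      h₂ * h₃ * (k s * k v) + h₂ * h₄ * (k s * k u) + h₃ * h₄ * (k s * k t)
    Q-congˡ h k ≡.refl ≡.refl ≡.refl ≡.refl = refl

    4*-cong : ∀ {x y} → x ≈ y → 4* x ≈ 4* y
    4*-cong x≈y = *-congˡ (*-congˡ x≈y)

    4*-zero : ∀ {x} → x ≈ 0# → 4* x ≈ 0#
    4*-zero x≈0 = y≈0⇒x*y≈0 (y≈0⇒x*y≈0 x≈0)

    δ-≢* : ∀ {p i : Fin r} → p ≢ i → ∀ {x} → δ p i * x ≈ 0#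
    δ-≢* p≢i = x≈0⇒x*y≈0 (reflexive (δ-≢ p≢i))

  module _ (off : OffDiagonalIndependent a b) (x : PairCoefficients r) (rel : Relation₂ x) where
    open PairCoefficients x renaming (pp to κ; pf to u; pg to v; fg to w)

    polarised : ∀ s t k l →
      sum₂ (λ p q → κ p q * 4* Q (δ p) (δ q) s t k l) +
      (sum (λ p → u p * 4* Q (δ p) a s t k l) + sum (λ p → v p * 4* Q (δ p) b s t k l)) +
      w * 4* Q a b s t k l ≈ 0#
    polarised s t k l = trans (sym (+-cong (+-cong
      (sum₂-cong {r} (λ p q → *-congˡ (⟪polar₄⟫ (z-isLinear p) (z-isLinear q) s t k l)))
      (+-cong (sum-cong {r} (λ p → *-congˡ (⟪polar₄⟫ (z-isLinear p) (linear-isLinear a) s t k l)))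
              (sum-cong {r} (λ p → *-congˡ (⟪polar₄⟫ (z-isLinear p) (linear-isLinear b) s t k l)))))
      (*-congˡ (⟪polar₄⟫ (linear-isLinear a) (linear-isLinear b) s t k l))))
      (rel (polar₄ s t k l))

    private
      -- Under the hypothesis only the i-th summands of the two single sums survive. Every term with
      -- a pair p < q drops out, because p or q differs from i and `Q` is symmetric in its two
      -- forms.
      at : ∀ i s t k l → (∀ p → p ≢ i → ∀ h → Q (δ p) h s t k l ≈ 0#) →
        u i * Q (δ i) a s t k l + v i * Q (δ i) b s t k l + w * Q a b s t k l ≈ 0#
      at i s t k l Q≈0 = 4*-cancel (begin
        4* (u i * Q (δ i) a s t k l + v i * Q (δ i) b s t k l + w * Q a b s t k l)
          ≈⟨ solve 6 (λ u v w x y z →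
               let 4∙_ : Polynomial 6 → Polynomial 6
                   4∙ x = (con 1 :+ con 1) :* ((con 1 :+ con 1) :* x) in
               4∙ (u :* x :+ v :* y :+ w :* z) :=
               con 0 :+ (u :* 4∙ x :+ v :* 4∙ y) :+ w :* 4∙ z) refl
               (u i) (v i) w (Q (δ i) a s t k l) (Q (δ i) b s t k l) (Q a b s t k l) ⟩
        0# + (u i * 4* Q (δ i) a s t k l + v i * 4* Q (δ i) b s t k l) + w * 4* Q a b s t k l
          ≈⟨ +-congʳ (+-cong (sum₂-zero {r} (λ p q p<q → y≈0⇒x*y≈0 (4*-zero (QQ≈0 p q (Fin.<⇒≢ p<q)))))
               (+-cong (sum-pick i (λ p p≢i → y≈0⇒x*y≈0 (4*-zero (Q≈0 p p≢i a))))
                       (sum-pick i (λ p p≢i → y≈0⇒x*y≈0 (4*-zero (Q≈0 p p≢i b)))))) ⟨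
        _
          ≈⟨ polarised s t k l ⟩
        0# ∎)
        where
        QQ≈0 : ∀ p q → p ≢ q → Q (δ p) (δ q) s t k l ≈ 0#
        QQ≈0 p q p≢q with p Fin.≟ i
        ... | no p≢i     = Q≈0 p p≢i (δ q)
        ... | yes ≡.refl = trans (Q-comm (δ p) (δ q) s t k l) (Q≈0 q (p≢q ∘ ≡.sym) (δ p))

    equations : Equations a b u v w
    equations = record { eq₄ = eq₄ ; eq₃₁ = eq₃₁ ; eq₂₁₁ = eq₂₁₁ ; eq₁₁₁₁ = eq₁₁₁₁ }
      where
      eq₄ : ∀ i → u i * (a i * a i) + v i * (b i * b i) + w * (a i * a i * (b i * b i)) ≈ 0#
      -- At iiii all six terms of `Q` agree, so the factor to cancel is 6 = 2 · 3.
      eq₄ i = cancel (cancel (begin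
        _ ≈⟨ solve 5 (λ a b u v w →
               let Q₁ x = con 1 :* con 1 :* (x :* x)
                   6Q₁ x = Q₁ x :+ Q₁ x :+ Q₁ x :+ Q₁ x :+ Q₁ x :+ Q₁ x
                   q = a :* a :* (b :* b) in
               (con 1 :+ con 1) :* ((con 1 :+ con 1 :+ con 1) :*
                 (u :* (a :* a) :+ v :* (b :* b) :+ w :* q)) :=
               u :* 6Q₁ a :+ v :* 6Q₁ b :+ w :* (q :+ q :+ q :+ q :+ q :+ q))
               refl (a i) (b i) (u i) (v i) w ⟩
        _ ≈⟨ +-congʳ (+-cong (*-congˡ (Q₁ a)) (*-congˡ (Q₁ b))) ⟨
        _ ≈⟨ at i i i i i (λ p p≢i h → Q-zeroˡ (δ p) h (δ-≢* p≢i) (δ-≢* p≢i) (δ-≢* p≢i)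
               (δ-≢* p≢i) (δ-≢* p≢i) (δ-≢* p≢i)) ⟩
        0# ∎) 2≉0) 3≉0
        where
        Q₁ : ∀ h → Q (δ i) h i i i i ≈ _
        Q₁ h = Q-congˡ (δ i) h (δ-refl i) (δ-refl i) (δ-refl i) (δ-refl i)

      eq₃₁ : ∀ i j → i ≢ j → u i * (a i * a j) + v i * (b i * b j) +
        w * (a i * a i * (b i * b j) + a i * a j * (b i * b i)) ≈ 0#
      -- At iiij the index j falls to `δ i` in three of the six terms, which vanish in `Q (δ i)`.
      -- The other three agree and give the factor 3.
      eq₃₁ i j i≢j = cancel (begin
        _ ≈⟨ solve 7 (λ a b u v w a′ b′ →
               let Q₁ x y = con 1 :* con 1 :* (x :* y) :+ con 1 :* con 1 :* (x :* y) :+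
                     con 1 :* con 0 :* (x :* x) :+ con 1 :* con 1 :* (x :* y) :+
                     con 1 :* con 0 :* (x :* x) :+ con 1 :* con 0 :* (x :* x)
                   q = a :* a :* (b :* b′)
                   q′ = a :* a′ :* (b :* b) in
               (con 1 :+ con 1 :+ con 1) :*
                 (u :* (a :* a′) :+ v :* (b :* b′) :+ w :* (q :+ q′)) :=
               u :* Q₁ a a′ :+ v :* Q₁ b b′ :+ w :* (q :+ q :+ q′ :+ q :+ q′ :+ q′))
               refl (a i) (b i) (u i) (v i) w (a j) (b j) ⟩
        _ ≈⟨ +-congʳ (+-cong (*-congˡ (Q₁ a)) (*-congˡ (Q₁ b))) ⟨
        _ ≈⟨ at i i i i j (λ p p≢i h → Q-zeroˡ (δ p) h (δ-≢* p≢i) (δ-≢* p≢i) (δ-≢* p≢i)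
               (δ-≢* p≢i) (δ-≢* p≢i) (δ-≢* p≢i)) ⟩
        0# ∎) 3≉0
        where
        Q₁ : ∀ h → Q (δ i) h i i i j ≈ _
        Q₁ h = Q-congˡ (δ i) h (δ-refl i) (δ-refl i) (δ-refl i) (δ-≢ i≢j)

      eq₂₁₁ : ∀ i j k → i ≢ j → i ≢ k → j ≢ k →
        u i * (a j * a k) + v i * (b j * b k) +
        w * (a i * a i * (b j * b k) + a j * a k * (b i * b i) +
             (1# + 1#) * (a i * a j * (b i * b k) + a i * a k * (b i * b j))) ≈ 0#
      eq₂₁₁ i j k i≢j i≢k j≢k = begin
        _ ≈⟨ solve 9 (λ a b u v w a′ b′ a″ b″ →
               let Q₁ x y z = con 1 :* con 1 :* (y :* z) :+ con 1 :* con 0 :* (x :* z) :+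
                     con 1 :* con 0 :* (x :* y) :+ con 1 :* con 0 :* (x :* z) :+
                     con 1 :* con 0 :* (x :* y) :+ con 0 :* con 0 :* (x :* x) in
               u :* (a′ :* a″) :+ v :* (b′ :* b″) :+
               w :* (a :* a :* (b′ :* b″) :+ a′ :* a″ :* (b :* b) :+
                 (con 1 :+ con 1) :* (a :* a′ :* (b :* b″) :+ a :* a″ :* (b :* b′))) :=
               u :* Q₁ a a′ a″ :+ v :* Q₁ b b′ b″ :+
               w :* (a :* a :* (b′ :* b″) :+ a :* a′ :* (b :* b″) :+ a :* a″ :* (b :* b′) :+
                 a :* a′ :* (b :* b″) :+ a :* a″ :* (b :* b′) :+ a′ :* a″ :* (b :* b)))
               refl (a i) (b i) (u i) (v i) w (a j) (b j) (a k) (b k) ⟩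
        _ ≈⟨ +-congʳ (+-cong (*-congˡ (Q₁ a)) (*-congˡ (Q₁ b))) ⟨
        _ ≈⟨ at i i i j k (λ p p≢i h → Q-zeroˡ (δ p) h (δ-≢* p≢i) (δ-≢* p≢i) (δ-≢* p≢i)
               (δ-≢* p≢i) (δ-≢* p≢i) (δδ≈0 p j≢k)) ⟩
        0# ∎
        where
        Q₁ : ∀ h → Q (δ i) h i i j k ≈ _
        Q₁ h = Q-congˡ (δ i) h (δ-refl i) (δ-refl i) (δ-≢ i≢j) (δ-≢ i≢k)

      eq₁₁₁₁ : ∀ i j k l → i ≢ j → i ≢ k → i ≢ l → j ≢ k → j ≢ l → k ≢ l → w * Q a b i j k l ≈ 0#
      eq₁₁₁₁ i j k l i≢j i≢k i≢l j≢k j≢l k≢l =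
        -- At four distinct indices `Q (δ p)` vanishes for every p. Thus `at i` applies, and its own
        -- two i-terms vanish as well.
        cancel-+ (trans (+-comm _ _) (at i i j k l (λ p _ → Q≈0 p)))
          (+-≈0 (y≈0⇒x*y≈0 (Q≈0 i a)) (y≈0⇒x*y≈0 (Q≈0 i b)))
        where
        Q≈0 : ∀ p h → Q (δ p) h i j k l ≈ 0#
        Q≈0 p h = Q-zeroˡ (δ p) h (δδ≈0 p i≢j) (δδ≈0 p i≢k) (δδ≈0 p i≢l)
          (δδ≈0 p j≢k) (δδ≈0 p j≢l) (δδ≈0 p k≢l)

    -- Once u, v and w vanish, polarising at iijj isolates `κ i j`: the only other assignment, p = j
    -- and q = i, is excluded by the order p < q.
    pairs-vanish : PairZero x
    pairs-vanish = pairZero κ≈0 (proj₁ ∘ uv≈0) (proj₂ ∘ uv≈0) (w≈0 off equations)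
      where
      uv≈0 = u,v≈0 off equations
      κ≈0 : ∀ i j → i < j → κ i j ≈ 0#
      κ≈0 i j i<j = 4*-cancel (begin
        4* κ i j
          ≈⟨ solve 1 (λ c →
               let 4∙_ : Polynomial 1 → Polynomial 1
                   4∙ x = (con 1 :+ con 1) :* ((con 1 :+ con 1) :* x) in
               4∙ c := c :* 4∙ (con 1 :* con 1 :* (con 1 :* con 1) :+ con 1 :* con 0 :* (con 0 :* con 1) :+
                 con 1 :* con 0 :* (con 0 :* con 1) :+ con 1 :* con 0 :* (con 0 :* con 1) :+
                 con 1 :* con 0 :* (con 0 :* con 1) :+ con 0 :* con 0 :* (con 0 :* con 0)))
               refl (κ i j) ⟩
        _ ≈⟨ *-congˡ (4*-cong (reflexive Qδδ)) ⟨
        κ i j * 4* Q (δ i) (δ j) i i j j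
          ≈⟨ sum₂-pick i j i<j (λ p q p<q pq≢ij → y≈0⇒x*y≈0 (4*-zero (Q≈0 p q p<q pq≢ij))) ⟨
        sum₂ (λ p q → κ p q * 4* Q (δ p) (δ q) i i j j)
          ≈⟨ cancel-+ (trans (sym (+-assoc _ _ _)) (polarised i i j j))
               (+-≈0 (+-≈0 (sum-zero {r} (λ p → x≈0⇒x*y≈0 (proj₁ (uv≈0 p))))
                           (sum-zero {r} (λ p → x≈0⇒x*y≈0 (proj₂ (uv≈0 p)))))
                     (x≈0⇒x*y≈0 (w≈0 off equations))) ⟩
        0# ∎)
        where
        i≢j : i ≢ j
        i≢j = Fin.<⇒≢ i<j
        Qδδ : Q (δ i) (δ j) i i j j ≡ _
        Qδδ rewrite δ-refl i | δ-refl j | δ-≢ i≢j | δ-≢ (i≢j ∘ ≡.sym) = ≡.refl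
        Q≈0 : ∀ p q → p < q → ¬ (p ≡ i × q ≡ j) → Q (δ p) (δ q) i i j j ≈ 0#
        Q≈0 p q p<q pq≢ij = +-≈0 (+-≈0 (+-≈0 (+-≈0 (+-≈0 first mixed) mixed) mixed) mixed) last
          where
          mixed : ∀ {y} → δ p i * δ p j * y ≈ 0#
          mixed = x≈0⇒x*y≈0 (δδ≈0 p i≢j)
          first : δ p i * δ p i * (δ q j * δ q j) ≈ 0#
          first with p Fin.≟ i | q Fin.≟ j
          ... | no p≢i  | _       = x≈0⇒x*y≈0 (δ-≢* p≢i)
          ... | _       | no q≢j  = y≈0⇒x*y≈0 (δ-≢* q≢j)
          ... | yes p≡i | yes q≡j = contradiction (p≡i , q≡j) pq≢ij
          last : δ p j * δ p j * (δ q i * δ q i) ≈ 0#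
          last with p Fin.≟ j | q Fin.≟ i
          ... | no p≢j     | _          = x≈0⇒x*y≈0 (δ-≢* p≢j)
          ... | _          | no q≢i     = y≈0⇒x*y≈0 (δ-≢* q≢i)
          ... | yes ≡.refl | yes ≡.refl = contradiction i<j (Fin.<-asym p<q)

  independent₁⇒independent₂ : Independent₁ → Independent₂
  independent₁⇒independent₂ li = pairs-vanish (independent₁⇒off-diagonal li)

-- From S₂ to S₁

module Dependence {c ℓ} {R : CommutativeRing c ℓ} (dom : IsStableDomain R) (r : ℕ)
    (a b : Fin r → CommutativeRing.Carrier R) where
  open CommutativeRing R hiding (zero)
  open Polynomials R r
  open Functionals R r
  open Combinations R
  open KroneckerSums R
  open Families R r
  open StableDomain dom
  open Independence dom r a b
  open import Algebra.Solver.Ring.NaturalCoefficients.Default commutativeSemiring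
  open import Algebra.Properties.Semiring.Sum semiring using (sum)
  open import Relation.Binary.Reasoning.Setoid setoid

  module _ (li : Independent₂) (u : Fin r → Carrier) (v w : Carrier) (rel : Relation₁ (u , v , w)) where

    -- The given relation holds under every functional, in particular under multiplication by `q`
    -- followed by `φ`.
    relation-times : ∀ φ q →
      sum (λ i → u i * ⟪ φ ⟫₂ (z² i) q) + (v * ⟪ φ ⟫₂ (a ²) q + w * ⟪ φ ⟫₂ (b ²) q) ≈ 0#
    relation-times φ q = trans
      (+-cong (sum-cong {r} λ i → *-congˡ (⟪⟫₂≈ φ (z² i) q))
        (+-cong (*-congˡ (⟪⟫₂≈ φ (a ²) q)) (*-congˡ (⟪⟫₂≈ φ (b ²) q))))
      (rel (λ d → ⟪ (λ e → φ (d ⊕ e)) ⟫ q))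

    private
      sum₂-0* : ∀ {g : Fin r → Fin r → Carrier} → sum₂ (λ i j → 0# * g i j) ≈ 0#
      sum₂-0* = sum₂-zero {r} (λ _ _ _ → zeroˡ _)

      sum-0* : ∀ {f : Fin r → Carrier} → sum (λ i → 0# * f i) ≈ 0#
      sum-0* = sum-zero {r} (λ _ → zeroˡ _)

    -- Multiplying by f₁² produces f₁⁴ only with coefficient v = 0, so the result is a relation
    -- within S₂. The next two lemmas multiply by f₂² and by z_k² in the same way.
    v≈0⇒zero : v ≈ 0# → (∀ i → u i ≈ 0#) × w ≈ 0#
    v≈0⇒zero v≈0 = PairZero.pf≈0 zeros , PairZero.fg≈0 zeros
      where
      relation : Relation₂ (coefficients (λ _ _ → 0#) u (λ _ → 0#) w)
      relation φ = begin
        _ ≈⟨ +-cong (+-cong sum₂-0* (+-congˡ sum-0*)) (*-congˡ (⟪⟫₂-comm φ (a ²) (b ²))) ⟩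
        0# + (X + 0#) + w * ⟪ φ ⟫₂ (b ²) (a ²)
          ≈⟨ +-congʳ (trans (+-identityˡ _) (+-identityʳ _)) ⟩
        X + w * ⟪ φ ⟫₂ (b ²) (a ²)
          ≈⟨ +-congˡ (trans (+-congʳ (x≈0⇒x*y≈0 v≈0)) (+-identityˡ _)) ⟨
        X + (v * ⟪ φ ⟫₂ (a ²) (a ²) + w * ⟪ φ ⟫₂ (b ²) (a ²))
          ≈⟨ relation-times φ (a ²) ⟩
        0# ∎
        where X = sum (λ i → u i * ⟪ φ ⟫₂ (z² i) (a ²))
      zeros = li _ relation

    w≈0⇒v≈0 : w ≈ 0# → v ≈ 0#
    w≈0⇒v≈0 w≈0 = PairZero.fg≈0 (li _ relation)
      where
      relation : Relation₂ (coefficients (λ _ _ → 0#) (λ _ → 0#) u v)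
      relation φ = begin
        _ ≈⟨ +-congʳ (+-cong sum₂-0* (+-congʳ sum-0*)) ⟩
        0# + (0# + X) + v * ⟪ φ ⟫₂ (a ²) (b ²)
          ≈⟨ +-congʳ (trans (+-identityˡ _) (+-identityˡ _)) ⟩
        X + v * ⟪ φ ⟫₂ (a ²) (b ²)
          ≈⟨ +-congˡ (trans (+-congˡ (x≈0⇒x*y≈0 w≈0)) (+-identityʳ _)) ⟨
        X + (v * ⟪ φ ⟫₂ (a ²) (b ²) + w * ⟪ φ ⟫₂ (b ²) (b ²))
          ≈⟨ relation-times φ (b ²) ⟩
        0# ∎
        where X = sum (λ i → u i * ⟪ φ ⟫₂ (z² i) (b ²))

    u≈0⇒v≈0 : ∀ k → u k ≈ 0# → v ≈ 0#
    u≈0⇒v≈0 k u≈0 = trans (sym (*-identityˡ v))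
      (trans (*-congʳ (reflexive (≡.sym (δ-refl k)))) (PairZero.pf≈0 (li _ relation) k))
      where
      -- These are the coefficients of z_k² times the relation. The missing square z_k⁴ has
      -- coefficient u_k = 0, and the conclusion is read off at z_k²f₁².
      relation : Relation₂ (coefficients (λ p q → δ k p * u q + δ k q * u p)
        (λ p → δ k p * v) (λ p → δ k p * w) 0#)
      relation φ = begin
        _ ≈⟨ trans (+-congˡ (zeroˡ _)) (+-identityʳ _) ⟩
        X + (sum (λ p → δ k p * v * ⟪ φ ⟫₂ (z² p) (a ²)) + sum (λ p → δ k p * w * ⟪ φ ⟫₂ (z² p) (b ²)))
          ≈⟨ +-cong (trans (sym (+-identityʳ X)) (+-congˡ (sym (x≈0⇒x*y≈0 u≈0))))
               (+-cong (pick v (a ²)) (pick w (b ²))) ⟩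
        X + u k * ⟪ φ ⟫₂ (z² k) (z² k) + (v * ⟪ φ ⟫₂ (a ²) (z² k) + w * ⟪ φ ⟫₂ (b ²) (z² k))
          ≈⟨ +-congʳ (sum₂-δ {r} k u (λ p q → ⟪ φ ⟫₂ (z² p) (z² q))
               (λ p q → ⟪⟫₂-comm φ (z² p) (z² q))) ⟩
        sum (λ i → u i * ⟪ φ ⟫₂ (z² i) (z² k)) + (v * ⟪ φ ⟫₂ (a ²) (z² k) + w * ⟪ φ ⟫₂ (b ²) (z² k))
          ≈⟨ relation-times φ (z² k) ⟩
        0# ∎
        where
        X = sum₂ (λ p q → (δ k p * u q + δ k q * u p) * ⟪ φ ⟫₂ (z² p) (z² q))
        pick : ∀ x q → sum (λ p → δ k p * x * ⟪ φ ⟫₂ (z² p) q) ≈ x * ⟪ φ ⟫₂ q (z² k)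
        pick x q = trans (sum-cong {r} (λ p → *-assoc _ _ _))
          (trans (sum-δ {r} k (λ p → x * ⟪ φ ⟫₂ (z² p) q)) (*-congˡ (⟪⟫₂-comm φ (z² k) q)))

    private
      -- The symmetric matrix of the quadratic form v f₁² + w f₂²; polarising the relation shows
      -- that it equals minus the diagonal matrix of the u_i.
      m : Fin r → Fin r → Carrier
      m i j = v * (a i * a j) + w * (b i * b j)

      polarised₂ : ∀ i j → sum (λ p → u p * ((1# + 1#) * (δ p i * δ p j))) +
        (v * ((1# + 1#) * (a i * a j)) + w * ((1# + 1#) * (b i * b j))) ≈ 0#
      polarised₂ i j = trans (sym (+-cong
        (sum-cong {r} (λ p → *-congˡ (⟪polar₂⟫ (z-isLinear p) i j)))
        (+-cong (*-congˡ (⟪polar₂⟫ (linear-isLinear a) i j))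
                (*-congˡ (⟪polar₂⟫ (linear-isLinear b) i j)))))
        (rel (polar₂ i j))

    off-diagonal : ∀ i j → i ≢ j → m i j ≈ 0#
    off-diagonal i j i≢j = cancel (trans
      (solve 4 (λ v w x y → (con 1 :+ con 1) :* (v :* x :+ w :* y) :=
        v :* ((con 1 :+ con 1) :* x) :+ w :* ((con 1 :+ con 1) :* y)) refl
        v w (a i * a j) (b i * b j))
      (cancel-+ (trans (+-comm _ _) (polarised₂ i j))
        (sum-zero {r} (λ p → y≈0⇒x*y≈0 (y≈0⇒x*y≈0 (δδ≈0 p i≢j)))))) 2≉0

    diagonal : ∀ i → u i + m i i ≈ 0#
    diagonal i = cancel (begin
      (1# + 1#) * (u i + m i i)
        ≈⟨ solve 5 (λ u v w x y → (con 1 :+ con 1) :* (u :+ (v :* x :+ w :* y)) :=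
             u :* ((con 1 :+ con 1) :* (con 1 :* con 1)) :+
             (v :* ((con 1 :+ con 1) :* x) :+ w :* ((con 1 :+ con 1) :* y))) refl
             (u i) v w (a i * a i) (b i * b i) ⟩
      _ ≈⟨ +-congʳ (*-congˡ (*-congˡ (*-cong (reflexive (δ-refl i)) (reflexive (δ-refl i))))) ⟨
      u i * ((1# + 1#) * (δ i i * δ i i)) +
        (v * ((1# + 1#) * (a i * a i)) + w * ((1# + 1#) * (b i * b i)))
        ≈⟨ +-congʳ (sum-pick i (λ p p≢i →
             y≈0⇒x*y≈0 (y≈0⇒x*y≈0 (x≈0⇒x*y≈0 (reflexive (δ-≢ p≢i)))))) ⟨
      _ ≈⟨ polarised₂ i i ⟩
      0# ∎) 2≉0

    -- The matrix m = v aaᵀ + w bbᵀ has rank at most 2, so its 3 × 3 minors vanish;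
    -- but m is diagonal, with entries - u i.
    three-indices⇒v≈0 : ∀ i j k → i ≢ j → i ≢ k → j ≢ k → v ≈ 0#
    three-indices⇒v≈0 i j k i≢j i≢k j≢k = stable λ v≉0 →
      let m≉0 : ∀ i → ¬ m i i ≈ 0#
          m≉0 i = v≉0 ∘ u≈0⇒v≈0 i ∘ cancel-+ (diagonal i) in
      *-≉0 (m≉0 i) (*-≉0 (m≉0 j) (m≉0 k)) minor
      where
      minor : m i i * (m j j * m k k) ≈ 0#
      minor = cancel-+ (trans
        -- The vanishing of the determinant, with its negative terms on the right so that it is an
        -- identity of semirings.
        (solve 8 (λ v w a b c p q r →
          let n = λ x y s t → v :* (x :* y) :+ w :* (s :* t) in
          n a a p p :* (n b b q q :* n c c r r) :+
            n a b p q :* ((con 1 :+ con 1) :* (n b c q r :* n a c p r)) :=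
          n a b p q :* (n a b p q :* n c c r r) :+ n a c p r :* (n a c p r :* n b b q q) :+
            n b c q r :* (n b c q r :* n a a p p))
          refl v w (a i) (a j) (a k) (b i) (b j) (b k))
        (+-≈0 (+-≈0 (x≈0⇒x*y≈0 (off-diagonal i j i≢j)) (x≈0⇒x*y≈0 (off-diagonal i k i≢k)))
              (x≈0⇒x*y≈0 (off-diagonal j k j≢k))))
        (x≈0⇒x*y≈0 (off-diagonal i j i≢j))

-- The case of two variables

module BinaryForms {c ℓ} {R : CommutativeRing c ℓ} (dom : IsStableDomain R)
    (a b : Fin 2 → CommutativeRing.Carrier R) where
  open CommutativeRing R hiding (zero)
  open Polynomials R 2
  open Functionals R 2
  open Combinations R
  open Families R 2
  open StableDomain dom
  open Independence dom 2 a b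
  open Dependence dom 2 a b
  open import Algebra.Properties.Group +-group using (∙-cancelʳ)
  open import Algebra.Solver.Ring.NaturalCoefficients.Default commutativeSemiring
  open import Relation.Binary.Reasoning.Setoid setoid

  private
    X Y T : Poly
    X = z² zero
    Y = z² (suc zero)
    T = z zero *ₚ z (suc zero)

    a₀ a₁ : Carrier
    a₀ = a zero
    a₁ = a (suc zero)

    expand : ∀ φ q → ⟪ φ ⟫₂ (a ²) q ≈
      a₀ * a₀ * ⟪ φ ⟫₂ X q + (1# + 1#) * (a₀ * a₁) * ⟪ φ ⟫₂ T q + a₁ * a₁ * ⟪ φ ⟫₂ Y q
    expand φ q = begin
      ⟪ φ ⟫₂ (a ²) q
        ≈⟨ trans (⟪⟫₂≈ φ (a ²) q) (⟪⟫-² ψ a) ⟩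
      _ ≈⟨ +-cong (*-congˡ (+-congˡ (+-congʳ (*-congˡ (⟪⟫-*ₚ-comm ψ (z (suc zero)) (z zero)))))) refl ⟩
      _ ≈⟨ solve 5 (λ a b x t y →
             a :* (a :* x :+ (b :* t :+ con 0)) :+ (b :* (a :* t :+ (b :* y :+ con 0)) :+ con 0) :=
             a :* a :* x :+ (con 1 :+ con 1) :* (a :* b) :* t :+ b :* b :* y)
             refl a₀ a₁ (⟪ ψ ⟫ X) (⟪ ψ ⟫ T) (⟪ ψ ⟫ Y) ⟩
      a₀ * a₀ * ⟪ ψ ⟫ X + (1# + 1#) * (a₀ * a₁) * ⟪ ψ ⟫ T + a₁ * a₁ * ⟪ ψ ⟫ Y
        ≈⟨ +-cong (+-cong (*-congˡ (⟪⟫₂≈ φ X q)) (*-congˡ (⟪⟫₂≈ φ T q))) (*-congˡ (⟪⟫₂≈ φ Y q)) ⟨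
      _ ∎
      where
      ψ : Vec ℕ 2 → Carrier
      ψ d = ⟪ (λ e → φ (d ⊕ e)) ⟫ q

    -- Both products compute to the same single term with exponents (2, 2). This coincidence is the
    -- source of the quartic identity.
    TT≈XY : ∀ φ → ⟪ φ ⟫₂ T T ≈ ⟪ φ ⟫₂ X Y
    TT≈XY φ = refl

    -- (f² - a₀² z₀² - a₁² z₁²)² = 4 a₀² a₁² z₀² z₁², with both sides moved so
    -- that no subtraction occurs.
    quartic : ∀ φ → let B = ⟪ φ ⟫₂ in
      B (a ²) (a ²) + (a₀ * a₀ * (a₀ * a₀) * B X X + a₁ * a₁ * (a₁ * a₁) * B Y Y) ≈
      (1# + 1#) * (a₀ * a₀ * (a₁ * a₁) * B X Y + a₀ * a₀ * B X (a ²) + a₁ * a₁ * B Y (a ²))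
    quartic φ = begin
      B (a ²) (a ²) + (a₀ * a₀ * (a₀ * a₀) * B X X + a₁ * a₁ * (a₁ * a₁) * B Y Y)
        ≈⟨ +-congʳ (trans (expand φ (a ²)) (+-cong (+-cong (*-congˡ Xf) (*-congˡ Tf)) (*-congˡ Yf))) ⟩
      _ ≈⟨ solve 7 (λ a b xx xy yy xt yt →
             let 2∙_ : Polynomial 7 → Polynomial 7
                 2∙ x = (con 1 :+ con 1) :* x
                 xf = a :* a :* xx :+ (con 1 :+ con 1) :* (a :* b) :* xt :+ b :* b :* xy
                 yf = a :* a :* xy :+ (con 1 :+ con 1) :* (a :* b) :* yt :+ b :* b :* yy
                 tf = a :* a :* xt :+ (con 1 :+ con 1) :* (a :* b) :* xy :+ b :* b :* yt in
             a :* a :* xf :+ (con 1 :+ con 1) :* (a :* b) :* tf :+ b :* b :* yf :+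
               (a :* a :* (a :* a) :* xx :+ b :* b :* (b :* b) :* yy) :=
             (con 1 :+ con 1) :* (a :* a :* (b :* b) :* xy :+ a :* a :* xf :+ b :* b :* yf))
             refl a₀ a₁ (B X X) (B X Y) (B Y Y) (B X T) (B Y T) ⟩
      _ ≈⟨ *-congˡ (+-cong (+-congˡ (*-congˡ Xf)) (*-congˡ Yf)) ⟨
      _ ∎
      where
      B = ⟪ φ ⟫₂
      Xf : B X (a ²) ≈ a₀ * a₀ * B X X + (1# + 1#) * (a₀ * a₁) * B X T + a₁ * a₁ * B X Y
      Xf = trans (⟪⟫₂-comm φ X (a ²)) (trans (expand φ X)
        (+-cong (+-congˡ (*-congˡ (⟪⟫₂-comm φ T X))) (*-congˡ (⟪⟫₂-comm φ Y X))))
      Yf : B Y (a ²) ≈ a₀ * a₀ * B X Y + (1# + 1#) * (a₀ * a₁) * B Y T + a₁ * a₁ * B Y Y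
      Yf = trans (⟪⟫₂-comm φ Y (a ²)) (trans (expand φ Y)
        (+-congʳ (+-congˡ (*-congˡ (⟪⟫₂-comm φ T Y)))))
      Tf : B T (a ²) ≈ a₀ * a₀ * B X T + (1# + 1#) * (a₀ * a₁) * B X Y + a₁ * a₁ * B Y T
      Tf = trans (⟪⟫₂-comm φ T (a ²)) (trans (expand φ T)
        (+-congʳ (+-congˡ (*-congˡ (TT≈XY φ)))))

  module _ (li : Independent₂) (u : Fin 2 → Carrier) (v w : Carrier) (rel : Relation₁ (u , v , w)) where
    private
      u₀ u₁ κ α β : Carrier
      u₀ = u zero
      u₁ = u (suc zero)
      κ = u₀ * u₁ * v
      α = v * u₁ * (a₀ * a₀ * (a₀ * a₀))
      β = v * u₀ * (a₁ * a₁ * (a₁ * a₁))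

      -- The given relation, multiplied by u₀ u₁ f², by α z₀² and by β z₁²,
      -- expresses κ f⁴, κ a₀⁴ z₀⁴ and κ a₁⁴ z₁⁴ by members of S₂; substituting
      -- this into κ times the quartic identity gives these coefficients.
      dependency : PairCoefficients 2
      dependency = coefficients
        (λ _ _ → α * u₁ + β * u₀ + κ * ((1# + 1#) * (a₀ * a₀ * (a₁ * a₁))))
        (λ { zero → u₀ * u₁ * u₀ + α * v + κ * ((1# + 1#) * (a₀ * a₀))
           ; (suc _) → u₀ * u₁ * u₁ + β * v + κ * ((1# + 1#) * (a₁ * a₁)) })
        (λ { zero → α * w ; (suc _) → β * w })
        (u₀ * u₁ * w)

      dependent : Relation₂ dependency
      -- `M` is the left side of `quartic φ`. Adding `κ * M` to both sides avoids subtracting the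
      -- fourth powers, which are not members of S₂.
      dependent φ = ∙-cancelʳ (κ * M) _ _ (begin
        pair z² (a ²) (b ²) dependency (⟪ φ ⟫ ∘ productₚ) + κ * M
          ≈⟨ solve 15 (λ u₀ u₁ v w a b xx xy yy xf yf xg yg ff fg →
               let κ = u₀ :* u₁ :* v
                   α = v :* u₁ :* (a :* a :* (a :* a))
                   β = v :* u₀ :* (b :* b :* (b :* b)) in
               (((α :* u₁ :+ β :* u₀ :+ κ :* ((con 1 :+ con 1) :* (a :* a :* (b :* b)))) :* xy :+ con 0)
                 :+ (con 0 :+ con 0) :+
               (((u₀ :* u₁ :* u₀ :+ α :* v :+ κ :* ((con 1 :+ con 1) :* (a :* a))) :* xf :+
                  ((u₀ :* u₁ :* u₁ :+ β :* v :+ κ :* ((con 1 :+ con 1) :* (b :* b))) :* yf :+ con 0)) :+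
                (α :* w :* xg :+ (β :* w :* yg :+ con 0))) :+
               u₀ :* u₁ :* w :* fg) :+
               κ :* (ff :+ (a :* a :* (a :* a) :* xx :+ b :* b :* (b :* b) :* yy)) :=
               u₀ :* u₁ :* (u₀ :* xf :+ (u₁ :* yf :+ con 0) :+ (v :* ff :+ w :* fg)) :+
               α :* (u₀ :* xx :+ (u₁ :* xy :+ con 0) :+ (v :* xf :+ w :* xg)) :+
               β :* (u₀ :* xy :+ (u₁ :* yy :+ con 0) :+ (v :* yf :+ w :* yg)) :+
               κ :* ((con 1 :+ con 1) :* (a :* a :* (b :* b) :* xy :+ a :* a :* xf :+ b :* b :* yf)))
               refl u₀ u₁ v w a₀ a₁ (B X X) (B X Y) (B Y Y) (B X f) (B Y f) (B X g) (B Y g) (B f f) (B f g) ⟩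
        _ ≈⟨ +-cong (+-≈0 (+-≈0 (y≈0⇒x*y≈0 times-f) (y≈0⇒x*y≈0 times-X)) (y≈0⇒x*y≈0 times-Y))
               (*-congˡ (sym (quartic φ))) ⟩
        0# + κ * M ∎)
        where
        B = ⟪ φ ⟫₂
        f = a ²
        g = b ²
        M = B f f + (a₀ * a₀ * (a₀ * a₀) * B X X + a₁ * a₁ * (a₁ * a₁) * B Y Y)
        times-f : u₀ * B X f + (u₁ * B Y f + 0#) + (v * B f f + w * B f g) ≈ 0#
        times-f = trans (+-congˡ (+-congˡ (*-congˡ (⟪⟫₂-comm φ f g)))) (relation-times li u v w rel φ f)
        times-X : u₀ * B X X + (u₁ * B X Y + 0#) + (v * B X f + w * B X g) ≈ 0#
        times-X = trans (+-cong (+-congˡ (+-congʳ (*-congˡ (⟪⟫₂-comm φ X Y))))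
          (+-cong (*-congˡ (⟪⟫₂-comm φ X f)) (*-congˡ (⟪⟫₂-comm φ X g)))) (relation-times li u v w rel φ X)
        times-Y : u₀ * B X Y + (u₁ * B Y Y + 0#) + (v * B Y f + w * B Y g) ≈ 0#
        times-Y = trans (+-congˡ (+-cong (*-congˡ (⟪⟫₂-comm φ Y f)) (*-congˡ (⟪⟫₂-comm φ Y g))))
          (relation-times li u v w rel φ Y)

    -- The dependency has coefficient u₀ u₁ w at f₁²f₂², which must vanish. If v were nonzero, so
    -- would be u₀, u₁ and w.
    two-indices⇒v≈0 : v ≈ 0#
    two-indices⇒v≈0 = stable λ v≉0 → v≉0 (w⇒v (cancel (PairZero.fg≈0 (li dependency dependent))
      (*-≉0 (v≉0 ∘ u⇒v zero) (v≉0 ∘ u⇒v (suc zero)))))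
      where
      u⇒v = u≈0⇒v≈0 li u v w rel
      w⇒v = w≈0⇒v≈0 li u v w rel

module _ {c ℓ} {R : CommutativeRing c ℓ} (dom : IsStableDomain R) where
  open CommutativeRing R hiding (zero)
  open Polynomials R

  -- It suffices to show v = 0, since the other coefficients then vanish by `v≈0⇒zero`. For r ≥ 3
  -- three distinct indices are available; r = 2 needs the quartic identity.
  independent₂⇒independent₁ : ∀ r → 2 ℕ.≤ r → (a b : Fin r → Carrier) →
    Independence.Independent₂ dom r a b → Independence.Independent₁ dom r a b
  independent₂⇒independent₁ r 2≤r a b li (u , v , w) rel =
    proj₁ others , v≈0 r 2≤r a b li u rel , proj₂ others
    where
    v≈0 : ∀ r → 2 ℕ.≤ r → (a b : Fin r → Carrier) (li : Independence.Independent₂ dom r a b)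
      (u : Fin r → Carrier) → Independence.Relation₁ dom r a b (u , v , w) → v ≈ 0#
    v≈0 2 _ a b li u rel = BinaryForms.two-indices⇒v≈0 dom a b li u v w rel
    v≈0 (suc (suc (suc r))) _ a b li u rel = Dependence.three-indices⇒v≈0 dom _ a b li u v w rel
      zero (suc zero) (suc (suc zero)) (λ ()) (λ ()) (λ ())
    v≈0 1 (ℕ.s≤s ()) a b li u rel
    others = Dependence.v≈0⇒zero dom r a b li u v w rel (v≈0 r 2≤r a b li u rel)

  pairs-independent⇔independent : ∀ r → 2 ℕ.≤ r → (a b : Fin r → Carrier) →
    LinearlyIndependent r (map (productₚ r) (choose 2 (Families.family R r a b))) ⇔
    LinearlyIndependent r (Families.family R r a b)
  pairs-independent⇔independent r 2≤r a b = mk⇔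
    (independent₁⇐ ∘ independent₂⇒independent₁ r 2≤r a b ∘ independent₂⇒)
    (independent₂⇐ ∘ independent₁⇒independent₂ ∘ independent₁⇒)
    where open Independence dom r a b

-- Real and complex numbers

-- The norm x² + y² of x + i y vanishes only at zero; this makes cancellation pass from R to R[i].
SumOfSquares : ∀ {c ℓ} → CommutativeRing c ℓ → Set (c ⊔ ℓ)
SumOfSquares R = ∀ x y → x * x + y * y ≈ 0# → x ≈ 0#
  where open CommutativeRing R

module Reals where

  0ᵣ : ℝ
  0ᵣ = fromℚ 0ℚ

  -- Apartness from 0, the positive form of being nonzero. Its negation is equivalent to being 0,
  -- which makes equality with 0 stable under double negation.
  Away : ℝ → Set
  Away x = ∃ λ δ → ∃ λ N → 0ℚ ℚ.< δ × (∀ n → N ≤ n → δ ℚ.≤ ∣ seq x n ∣)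

  private
    p-0≡p : ∀ p → p ℚ.- 0ℚ ≡ p
    p-0≡p = ℚ.+-identityʳ

    halves : ∀ p → ½ ℚ.* p ℚ.+ ½ ℚ.* p ≡ p
    halves p = ≡.trans (≡.sym (ℚ.*-distribʳ-+ p ½ ½)) (ℚ.*-identityˡ p)

    *-pos : ∀ {p q} → 0ℚ ℚ.< p → 0ℚ ℚ.< q → 0ℚ ℚ.< p ℚ.* q
    *-pos {p} {q} 0<p 0<q =
      ℚ.positive⁻¹ _ {{ℚ.pos*pos⇒pos p {{ℚ.positive 0<p}} q {{ℚ.positive 0<q}}}}

    ∣p∣≤∣p-q∣+∣q∣ : ∀ p q → ∣ p ∣ ℚ.≤ ∣ p ℚ.- q ∣ ℚ.+ ∣ q ∣
    ∣p∣≤∣p-q∣+∣q∣ p q = ≡.subst (λ t → ∣ t ∣ ℚ.≤ ∣ p ℚ.- q ∣ ℚ.+ ∣ q ∣)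
      (solve 2 (λ p q → p :- q :+ q := p) ≡.refl p q) (ℚ.∣p+q∣≤∣p∣+∣q∣ (p ℚ.- q) q)
      where open +-*-Solver using (solve; _:+_; _:-_; _:=_)

    *-mono-≤ : ∀ {p q r s} → 0ℚ ℚ.< p → 0ℚ ℚ.< r → p ℚ.≤ q → r ℚ.≤ s → p ℚ.* r ℚ.≤ q ℚ.* s
    *-mono-≤ {p} {q} {r} {s} 0<p 0<r p≤q r≤s = ℚ.≤-trans
      (ℚ.*-monoʳ-≤-nonNeg r {{ℚ.pos⇒nonNeg r {{ℚ.positive 0<r}}}} p≤q)
      (ℚ.*-monoˡ-≤-nonNeg q {{ℚ.pos⇒nonNeg q {{ℚ.positive (ℚ.<-≤-trans 0<p p≤q)}}}} r≤s)

    square-∣∣ : ∀ p → p ℚ.* p ≡ ∣ p ∣ ℚ.* ∣ p ∣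
    square-∣∣ p with ℚ.∣p∣≡p∨∣p∣≡-p p
    ... | inj₁ e = ≡.sym (≡.cong₂ ℚ._*_ e e)
    ... | inj₂ e = ≡.trans (solve 1 (λ p → p :* p := (:- p) :* (:- p)) ≡.refl p)
                           (≡.sym (≡.cong₂ ℚ._*_ e e))
      where open +-*-Solver using (solve; _:*_; :-_; _:=_)

    0≤square : ∀ p → 0ℚ ℚ.≤ p ℚ.* p
    0≤square p = ≡.subst (0ℚ ℚ.≤_) (≡.trans (ℚ.∣p*q∣≡∣p∣*∣q∣ p p) (≡.sym (square-∣∣ p))) (ℚ.0≤∣p∣ (p ℚ.* p))

  -- Past an index where the terms differ by less than ε/2, a single term of size at least ε would
  -- keep all later terms at size at least ε/2, so the number would be apart from 0. Comparison of
  -- rationals is decidable, so all terms past that index are below ε.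
  ¬Away⇒≈0 : ∀ {x} → ¬ Away x → x ≈ᵣ 0ᵣ
  ¬Away⇒≈0 {x} ¬away = mk≈ (mkNull go)
    where
    open ℚ.≤-Reasoning
    go : ∀ ε → 0ℚ ℚ.< ε → ∃ λ N → ∀ m n → N ≤ m → N ≤ n → ∣ seq x m ℚ.- 0ℚ ∣ ℚ.< ε
    go ε 0<ε with Null.tail (cauchy x) (½ ℚ.* ε) (*-pos (ℚ.positive⁻¹ ½) 0<ε)
    ... | N , close = N , λ m _ N≤m _ → ≡.subst (λ t → ∣ t ∣ ℚ.< ε) (≡.sym (p-0≡p (seq x m))) (small m N≤m)
      where
      large : ∀ m → N ≤ m → ε ℚ.≤ ∣ seq x m ∣ → ∀ n → N ≤ n → ½ ℚ.* ε ℚ.≤ ∣ seq x n ∣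
      large m N≤m ε≤ n N≤n = ℚ.≮⇒≥ λ below → ℚ.<-irrefl ≡.refl (begin-strict
        ε                                        ≤⟨ ε≤ ⟩
        ∣ seq x m ∣                              ≤⟨ ∣p∣≤∣p-q∣+∣q∣ (seq x m) (seq x n) ⟩
        ∣ seq x m ℚ.- seq x n ∣ ℚ.+ ∣ seq x n ∣  <⟨ ℚ.+-mono-< (close m n N≤m N≤n) below ⟩
        ½ ℚ.* ε ℚ.+ ½ ℚ.* ε                      ≡⟨ halves ε ⟩
        ε                                        ∎)
      small : ∀ m → N ≤ m → ∣ seq x m ∣ ℚ.< ε
      small m N≤m with ∣ seq x m ∣ ℚ.<? ε
      ... | yes below = below
      ... | no ¬below = contradiction
        (½ ℚ.* ε , N , *-pos (ℚ.positive⁻¹ ½) 0<ε , large m N≤m (ℚ.≮⇒≥ ¬below)) ¬away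

  Away⇒≉0 : ∀ {x} → Away x → ¬ x ≈ᵣ 0ᵣ
  Away⇒≉0 {x} (δ , N , 0<δ , far) x≈0 with Null.tail (null x≈0) δ 0<δ
  ... | M , small = ℚ.<-irrefl ≡.refl (ℚ.≤-<-trans (far n (ℕ.m≤m⊔n N M))
        (≡.subst (λ t → ∣ t ∣ ℚ.< δ) (p-0≡p (seq x n)) (small n n (ℕ.m≤n⊔m N M) (ℕ.m≤n⊔m N M))))
    where n = N ℕ.⊔ M

  Away-* : ∀ {x y} → Away x → Away y → Away (x *ᵣ y)
  Away-* {x} {y} (δ , N , 0<δ , far) (ε , M , 0<ε , far′) =
    δ ℚ.* ε , N ℕ.⊔ M , *-pos 0<δ 0<ε , λ n N⊔M≤n →
      ≡.subst (δ ℚ.* ε ℚ.≤_) (≡.sym (ℚ.∣p*q∣≡∣p∣*∣q∣ (seq x n) (seq y n)))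
        (*-mono-≤ 0<δ 0<ε (far n (ℕ.m⊔n≤o⇒m≤o N M N⊔M≤n)) (far′ n (ℕ.m⊔n≤o⇒n≤o N M N⊔M≤n)))

  Away-sum-of-squares : ∀ {x} y → Away x → Away (x *ᵣ x +ᵣ y *ᵣ y)
  Away-sum-of-squares {x} y (δ , N , 0<δ , far) = δ ℚ.* δ , N , *-pos 0<δ 0<δ , λ n N≤n →
    let p = seq x n; q = seq y n in begin
    δ ℚ.* δ                    ≤⟨ *-mono-≤ 0<δ 0<δ (far n N≤n) (far n N≤n) ⟩
    ∣ p ∣ ℚ.* ∣ p ∣            ≡⟨ square-∣∣ p ⟨
    p ℚ.* p                    ≡⟨ ℚ.+-identityʳ (p ℚ.* p) ⟨
    p ℚ.* p ℚ.+ 0ℚ             ≤⟨ ℚ.+-monoʳ-≤ (p ℚ.* p) (0≤square q) ⟩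
    p ℚ.* p ℚ.+ q ℚ.* q        ≡⟨ ℚ.0≤p⇒∣p∣≡p (ℚ.+-mono-≤ (0≤square p) (0≤square q)) ⟨
    ∣ p ℚ.* p ℚ.+ q ℚ.* q ∣    ∎
    where open ℚ.≤-Reasoning

  -- The tail condition at ε = 1 would give |q| < 1. Asking for a constant sequence instead of
  -- `fromℚ q` itself covers sums such as `1# + 1#`.
  fromℚ-≉0 : ∀ {x} q → ¬ ∣ q ℚ.- 0ℚ ∣ ℚ.< 1ℚ → (∀ n → seq x n ≡ q) → ¬ x ≈ᵣ 0ᵣ
  fromℚ-≉0 q far x≡q x≈0 with Null.tail (null x≈0) 1ℚ (ℚ.positive⁻¹ 1ℚ)
  ... | N , small = far (≡.subst (λ t → ∣ t ℚ.- 0ℚ ∣ ℚ.< 1ℚ) (x≡q N) (small N N ℕ.≤-refl ℕ.≤-refl))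

  ℝ-isStableDomain : IsStableDomain ℝ-commutativeRing
  ℝ-isStableDomain = record
    { stable = λ ¬¬x≈0 → ¬Away⇒≈0 (¬¬x≈0 ∘ Away⇒≉0)
    -- If `y` were apart from 0, then `x` could not be, as the product would be; so `x` would be 0.
    ; cancel = λ {x} {y} xy≈0 x≉0 → ¬Away⇒≈0 λ away-y → x≉0 (¬Away⇒≈0 λ away-x →
        Away⇒≉0 (Away-* {x} {y} away-x away-y) xy≈0)
    ; 2≉0    = fromℚ-≉0 2ℚ (from-no (∣ 2ℚ ℚ.- 0ℚ ∣ ℚ.<? 1ℚ)) (λ _ → ≡.refl)
    ; 3≉0    = fromℚ-≉0 3ℚ (from-no (∣ 3ℚ ℚ.- 0ℚ ∣ ℚ.<? 1ℚ)) (λ _ → ≡.refl)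
    }
    where
    2ℚ 3ℚ : ℚ
    2ℚ = 1ℚ ℚ.+ 1ℚ
    3ℚ = 2ℚ ℚ.+ 1ℚ

  ℝ-sumOfSquares : SumOfSquares ℝ-commutativeRing
  ℝ-sumOfSquares x y sum≈0 =
    ¬Away⇒≈0 λ away → Away⇒≉0 (Away-sum-of-squares {x} y away) sum≈0

-- Passage from R to R[i]

module AdjoinIDomain {c ℓ} {R : CommutativeRing c ℓ} (dom : IsStableDomain R)
    (sumOfSquares : SumOfSquares R) where
  open CommutativeRing R hiding (zero)
  open StableDomain dom
  open AdjoinI R using (_+i_; _,_; re≈; im≈; _≈ᵢ_; 0ᵢ)
  open import Algebra.Properties.Ring ring using (-1*x≈-x)
  open import Algebra.Solver.Ring.NaturalCoefficients.Default commutativeSemiring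
  open import Relation.Binary.Reasoning.Setoid setoid

  private
    minus : ∀ x y → x - y ≈ x + - 1# * y
    minus x y = +-congˡ (sym (-1*x≈-x y))

    -- The real and imaginary parts of (a - b i) (a + b i) (c + d i).
    norm*re : ∀ a b c d → a * c - b * d ≈ 0# → a * d + b * c ≈ 0# → (a * a + b * b) * c ≈ 0#
    -- The added multiple of 1 + (-1) is zero. It makes the equation a semiring identity in which -1
    -- is treated as a variable.
    norm*re a b c d re≈0 im≈0 = cancel-+ (begin
      (a * a + b * b) * c + (1# + - 1#) * (a * b * d)
        ≈⟨ solve 5 (λ n a b c d →
             (a :* a :+ b :* b) :* c :+ (con 1 :+ n) :* (a :* b :* d) :=
             a :* (a :* c :+ n :* (b :* d)) :+ b :* (a :* d :+ b :* c)) refl (- 1#) a b c d ⟩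
      a * (a * c + - 1# * (b * d)) + b * (a * d + b * c)
        ≈⟨ +-≈0 (y≈0⇒x*y≈0 (trans (sym (minus _ _)) re≈0)) (y≈0⇒x*y≈0 im≈0) ⟩
      0# ∎) (x≈0⇒x*y≈0 (-‿inverseʳ 1#))

    norm*im : ∀ a b c d → a * c - b * d ≈ 0# → a * d + b * c ≈ 0# → (a * a + b * b) * d ≈ 0#
    norm*im a b c d re≈0 im≈0 = cancel-+ (begin
      (a * a + b * b) * d + b * (a * c + - 1# * (b * d))
        ≈⟨ solve 5 (λ n a b c d →
             (a :* a :+ b :* b) :* d :+ b :* (a :* c :+ n :* (b :* d)) :=
             a :* (a :* d :+ b :* c) :+ (con 1 :+ n) :* (b :* b :* d)) refl (- 1#) a b c d ⟩
      a * (a * d + b * c) + (1# + - 1#) * (b * b * d)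
        ≈⟨ +-≈0 (y≈0⇒x*y≈0 im≈0) (x≈0⇒x*y≈0 (-‿inverseʳ 1#)) ⟩
      0# ∎) (y≈0⇒x*y≈0 (trans (sym (minus _ _)) re≈0))

    norm≉0 : ∀ a b → ¬ (a +i b) ≈ᵢ 0ᵢ → ¬ a * a + b * b ≈ 0#
    norm≉0 a b z≉0 norm≈0 = z≉0 (sumOfSquares a b norm≈0 , sumOfSquares b a (trans (+-comm _ _) norm≈0))

  isStableDomain : IsStableDomain (AdjoinI.commutativeRing R)
  isStableDomain = record
    { stable = λ ¬¬z≈0 → stable (λ re≉0 → ¬¬z≈0 (re≉0 ∘ re≈)) , stable (λ im≉0 → ¬¬z≈0 (im≉0 ∘ im≈))
    ; cancel = λ { {a +i b} {c +i d} (re≈0 , im≈0) z≉0 →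
        cancel (norm*re a b c d re≈0 im≈0) (norm≉0 a b z≉0) ,
        cancel (norm*im a b c d re≈0 im≈0) (norm≉0 a b z≉0) }
    ; 2≉0    = 2≉0 ∘ re≈
    ; 3≉0    = 3≉0 ∘ re≈
    }

ℂ-isStableDomain : IsStableDomain ℂ-commutativeRing
ℂ-isStableDomain = AdjoinIDomain.isStableDomain Reals.ℝ-isStableDomain Reals.ℝ-sumOfSquares

theorem1p2 : (r : ℕ) → 2 ≤ r → (a : Fin 2 → Fin r → ℂ) →
    let open Polynomials ℂ-commutativeRing r in
    LinearlyIndependent (S 2 a) ⇔ LinearlyIndependent (S₁ a)
theorem1p2 r 2≤r a = pairs-independent⇔independent ℂ-isStableDomain r 2≤r (a zero) (a (suc zero))
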